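{- Let $r\ge1$ and let $k_0,\dots,k_r$ be nonnegative integers, and put $n=1+k_0+\cdots+k_r$. The number of $r$-permutations $\pi$ of $[n]$ such that $S(\pi)$ is the identity permutation $12\cdots n$ and such that, for each $i=0,\dots,r$, $\pi$ has exactly $k_i$ descents of type $i$, equals $$\frac{1}{n}\prod_{i=0}^{r}\binom{n}{k_i}.$$
   Context: An $r$-permutation of a finite set $A$ of positive integers is a word in which each element of $A$ appears exactly $r$ times, such that whenever $i<j<k$ and $a_i=a_k$ we have $a_j\le a_i$; for $A=[n]=\{1,\dots,n\}$ this is an $r$-permutation of $[n]$. The stack-sorting operation $S$: on words with distinct letters, $S(\emptyset)=\emptyset$ and if $m$ is the largest letter and $\pi=\pi_l\,m\,\pi_r$ then $S(\pi)=S(\pi_l)S(\pi_r)m$. On a nonempty $r$-permutation $\pi$ with largest letter $m$, write $\pi=\alpha_1 m\alpha_2 m\cdots m\alpha_{r+1}$ (each $\alpha_i$ is an $r$-permutation of some set, possibly empty) and set $S(\pi)=S(\alpha_1)S(\alpha_2)\cdots S(\alpha_{r+1})\,m$, with $S(\emptyset)=\emptyset$; $S(\pi)$ is a word with distinct letters. Descents: a letter $a$ of $\pi$ is a type $i$ descent ($1\le i\le r$) if the $i$th occurrence of $a$ is immediately followed by a smaller letter, and a type $0$ descent if the first occurrence of $a$ immediately follows a smaller letter. -}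

module Defs where

open import Data.Bool using (Bool; true; false; _∧_; _∨_; not; if_then_else_)
open import Data.Nat using (ℕ; zero; suc; _+_; _*_; _⊔_; _≡ᵇ_; _<ᵇ_; _≤ᵇ_)
open import Data.Nat.Combinatorics using (_C_)
open import Data.Fin using (Fin; toℕ)
open import Data.Maybe using (Maybe; just; nothing)
open import Data.List using (List; []; _∷_; _++_; length; filter; map; concatMap; foldr; applyUpTo; allFin)
open import Data.Bool.ListAction using (all; any)
open import Data.List.Properties using (≡-dec)
open import Data.Nat.Properties using (_≟_)
open import Relation.Nullary.Decidable using (⌊_⌋)
open import Relation.Binary.PropositionalEquality using (_≡_)

-- Words are lists of positive integers.
Word : Set
Word = List ℕ

occ : ℕ → Word → ℕ
occ a w = length (filter (λ x → x ≟ a) w)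

maxLetter : Word → ℕ
maxLetter = foldr _⊔_ 0

splitOn : ℕ → Word → List Word
splitOn m [] = [] ∷ []
splitOn m (x ∷ w) with splitOn m w
... | [] = [] -- unreachable
... | (α ∷ αs) = if x ≡ᵇ m then [] ∷ α ∷ αs else (x ∷ α) ∷ αs

-- Stack-sorting with fuel: S(∅)=∅, S(α₁ m α₂ ⋯ m α_{t+1}) = S(α₁)⋯S(α_{t+1}) m,
-- m the largest letter.  (For words with distinct letters this is the usual S.)
stackFuel : ℕ → Word → Word
stackFuel zero w = []
stackFuel (suc f) [] = []
stackFuel (suc f) (x ∷ w) =
  concatMap (stackFuel f) (splitOn (maxLetter (x ∷ w)) (x ∷ w)) ++ (maxLetter (x ∷ w) ∷ [])

-- fuel = length suffices, since every α_i is strictly shorter than the word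
S : Word → Word
S w = stackFuel (length w) w

idPerm : ℕ → Word
idPerm n = applyUpTo suc n

-- a word a₁⋯a_L satisfies: whenever i<j<k and a_i = a_k then a_j ≤ a_i.
-- okFrom a t : every letter of t that precedes a later occurrence of a in t is ≤ a.
okFrom : ℕ → Word → Bool
okFrom a [] = true
okFrom a (x ∷ t) =
  ((x ≤ᵇ a) ∨ not (any (λ y → y ≡ᵇ a) t)) ∧ okFrom a t

nestedCond : Word → Bool
nestedCond [] = true
nestedCond (a ∷ t) = okFrom a t ∧ nestedCond t

isRPerm : ℕ → ℕ → Word → Bool
isRPerm r n w =
  all (λ x → (1 ≤ᵇ x) ∧ (x ≤ᵇ n)) w
  ∧ all (λ a → occ a w ≡ᵇ r) (applyUpTo suc n)
  ∧ nestedCond w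

-- number of descents of type i of w.
-- We scan the positions; `seen` holds the letters strictly to the left.
-- type 0   : position holds the 1st occurrence of a and the previous letter is < a
-- type i≥1 : position holds the i-th occurrence of a and the next letter is < a
-- (each letter has exactly one k-th occurrence, so counting positions = counting letters)
descGo : ℕ → Maybe ℕ → Word → Word → ℕ
descGo i prev seen [] = 0
descGo i prev seen (a ∷ t) = test i prev t + descGo i (just a) (a ∷ seen) t
  where
  prevSmaller : Maybe ℕ → Bool
  prevSmaller nothing = false
  prevSmaller (just p) = p <ᵇ a
  nextSmaller : Word → Bool
  nextSmaller [] = false
  nextSmaller (b ∷ _) = b <ᵇ a
  test : ℕ → Maybe ℕ → Word → ℕ
  test zero p t' = if (occ a seen ≡ᵇ 0) ∧ prevSmaller p then 1 else 0
  test (suc j) p t' = if (occ a seen ≡ᵇ j) ∧ nextSmaller t' then 1 else 0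

descents : ℕ → Word → ℕ
descents i w = descGo i nothing [] w

wordsOver : ℕ → ℕ → List Word
wordsOver zero n = [] ∷ []
wordsOver (suc L) n = concatMap (λ w → map (λ x → x ∷ w) (applyUpTo suc n)) (wordsOver L n)

-- every r-permutation of [n] has length r*n and letters in [n], so it is in wordsOver (r*n) n
sumFin : (m : ℕ) → (Fin m → ℕ) → ℕ
sumFin zero k = 0
sumFin (suc m) k = k Fin.zero + sumFin m (λ i → k (Fin.suc i))

prodFin : (m : ℕ) → (Fin m → ℕ) → ℕ
prodFin zero k = 1
prodFin (suc m) k = k Fin.zero * prodFin m (λ i → k (Fin.suc i))

counted : (r n : ℕ) → (Fin (suc r) → ℕ) → Word → Bool
counted r n k π =
  isRPerm r n π
  ∧ ⌊ ≡-dec _≟_ (S π) (idPerm n) ⌋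
  ∧ all (λ i → descents (toℕ i) π ≡ᵇ k i) (allFin (suc r))

countRPerms : (r n : ℕ) → (Fin (suc r) → ℕ) → ℕ
countRPerms r n k = length (filter (λ π → counted r n k π Data.Bool.≟ true) (wordsOver (r * n) n))

{-# OPTIONS --safe #-}

-- Sorting to the identity forces the pieces between the copies of the largest letter to be words
-- of the same kind on consecutive intervals, so the words in question are the (r+1)-ary trees with
-- n nodes, and a type i descent is a node whose child number i is present.  Forests are counted by
-- removing the first root: if b roots and k_i children of type i make n nodes, there are
-- b/n · ∏ C(n, k_i) of them, by induction on n from the Vandermonde-type sums
-- ∑_s ∏ C(n, k_i - s_i) = ∏ C(n+1, k_i) and (n+1) ∑_s |s| ∏ C(n, k_i - s_i) = (∑ k_i) ∏ C(n+1, k_i)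
-- over the sets s of children of that root.

module Submission where

open import Defs
open import Data.Bool using (Bool; _∧_; _∨_; false; if_then_else_; not; true)
open import Data.Nat using (_*_; _+_; _<_; _<ᵇ_; _≡ᵇ_; _≤_; _≤ᵇ_; suc; s≤s; s≤s⁻¹; zero; z≤n; ℕ)
open import Data.Nat.Combinatorics using (_C_; nCk+nC[k+1]≡[n+1]C[k+1])
open import Data.Nat.ListAction using (sum)
open import Data.Nat.ListAction.Properties using (sum-++)
open import Data.Nat.Solver using (module +-*-Solver)
open import Data.Fin using (Fin; suc; toℕ; zero)
open import Data.Product using (_,_; _×_; proj₁; proj₂; ∃; ∃₂)
open import Data.List using
  ( List; []; [_]; _++_; _ʳ++_; _∷_; _∷ʳ_; allFin; applyUpTo; concat; concatMap; filter; length;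
    map )
open import Data.List.Properties using
  ( ++-assoc; ++-identityʳ; ++-ʳ++; filter-++; filter-accept; filter-reject; length-++; length-map;
    map-++; map-cong; map-cong-local; map-∘; ∷-injective; ∷ʳ-injective; ≡-dec )
open import Data.List.Membership.Propositional using (_∈_; find; lose)
open import Data.List.Membership.Propositional.Properties using
  ( ∈-++⁺ʳ; ∈-++⁺ˡ; ∈-++⁻; ∈-applyUpTo⁺; ∈-concatMap⁺; ∈-concatMap⁻; ∈-filter⁺; ∈-filter⁻;
    ∈-length; ∈-map⁺; ∈-map⁻ )
open import Data.List.Relation.Unary.All using (All; []; _∷_)
open import Data.List.Relation.Unary.Any using (here; there)
open import Data.List.Relation.Unary.AllPairs using ([]; _∷_)
open import Data.List.Relation.Unary.Unique.Propositional using (Unique)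
open import Data.Vec using (Vec; []; _∷_; lookup; replicate; tabulate)
open import Data.Sum using (inj₁; inj₂)
open import Function using (Equivalence; _∘_; id; mk⇔)
open import Relation.Nullary using (contradiction; no; yes)
open import Data.Bool.ListAction using (all; any)
open import Data.Bool.Properties using (T-∧; T-≡; ∧-conicalʳ; ∧-conicalˡ; ∨-zeroʳ)
open import Data.Maybe using (Maybe; just; nothing)
open import Relation.Nullary.Decidable using (dec-false; dec-true; fromWitness; toWitness; ⌊_⌋)
open import Data.Unit using (tt; ⊤)
open import Data.List.Membership.Propositional.Properties.WithK using (unique∧set⇒bag)
open import Data.List.Relation.Binary.BagAndSetEquality using (∼bag⇒↭)
open import Data.List.Relation.Binary.Permutation.Propositional.Properties using (↭-length)
open import Data.Nat.Properties
import Data.Bool as Bool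
import Data.List.Relation.Unary.All as All
import Data.List.Relation.Unary.All.Properties as Allₚ
import Data.List.Relation.Unary.Unique.Propositional.Properties as Unique
import Data.Vec as Vec
import Data.Vec.Properties as Vecₚ
open import Relation.Binary.PropositionalEquality hiding ([_])

-- A single tree resists recursion on its subtrees, since the counts k_i would have to be shared out
-- among all of them. Replacing the first root by its children leaves a forest, so the set of roots
-- becomes a parameter; it is a 0/1-vector because absent children keep their positions. On the side
-- of words, a node is labelled by its postorder number shifted by an offset, which makes the pieces
-- sort to consecutive intervals. The r copies of the root's letter separate r+1 pieces: piece 0
-- stands before the first copy and piece i right after the i-th, so this letter is a type i descent
-- exactly when piece i is nonempty. The delicate case is an empty piece: the neighbour is then
-- another copy of the same letter, the letter of an ancestor, or nothing at all, and none of these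
-- is a smaller letter.

private variable
  A B : Set
  j m n : ℕ

-- 0/1-vectors below a vector of counts

toBit : Bool → ℕ
toBit false = 0
toBit true  = 1

weight : Vec Bool n → ℕ
weight []      = 0
weight (b ∷ s) = toBit b + weight s

weight-++ : (s : Vec Bool m) (t : Vec Bool n) → weight (s Vec.++ t) ≡ weight s + weight t
weight-++ []      t = refl
weight-++ (b ∷ s) t =
    trans (cong (toBit b +_) (weight-++ s t)) (sym (+-assoc (toBit b) (weight s) (weight t)))

weight-replicate-false : ∀ n → weight (replicate n false) ≡ 0
weight-replicate-false zero    = refl
weight-replicate-false (suc n) = weight-replicate-false n

-- _C_ binds more loosely than _*_, so the binomial coefficient needs its parentheses.
binomials : ℕ → Vec ℕ m → ℕ
binomials n []      = 1
binomials n (x ∷ k) = (n C x) * binomials n k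

-- All ways of writing k as the sum of a 0/1-vector s and a vector l.
submasks : Vec ℕ m → List (Vec Bool m × Vec ℕ m)
submasks []          = ([] , []) ∷ []
submasks (zero  ∷ k) = map (λ (s , l) → false ∷ s , zero ∷ l) (submasks k)
submasks (suc x ∷ k) = map (λ (s , l) → false ∷ s , suc x ∷ l) (submasks k)
                    ++ map (λ (s , l) → true ∷ s , x ∷ l) (submasks k)

submasks-sound : (k : Vec ℕ m) {s : Vec Bool m} {l : Vec ℕ m} → (s , l) ∈ submasks k →
                 ∀ i → lookup k i ≡ toBit (lookup s i) + lookup l i
submasks-sound (zero ∷ k) p i with ∈-map⁻ _ p
submasks-sound (zero ∷ k) p zero    | _ , q , refl = refl
submasks-sound (zero ∷ k) p (suc i) | _ , q , refl = submasks-sound k q i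
submasks-sound (suc x ∷ k) p i with ∈-++⁻ (map _ (submasks k)) p
... | inj₁ p′ with ∈-map⁻ _ p′
submasks-sound (suc x ∷ k) p zero    | inj₁ _ | _ , q , refl = refl
submasks-sound (suc x ∷ k) p (suc i) | inj₁ _ | _ , q , refl = submasks-sound k q i
submasks-sound (suc x ∷ k) p i | inj₂ p′ with ∈-map⁻ _ p′
submasks-sound (suc x ∷ k) p zero    | inj₂ _ | _ , q , refl = refl
submasks-sound (suc x ∷ k) p (suc i) | inj₂ _ | _ , q , refl = submasks-sound k q i

submasks-complete : (k : Vec ℕ m) (s : Vec Bool m) (l : Vec ℕ m) →
                    (∀ i → lookup k i ≡ toBit (lookup s i) + lookup l i) → (s , l) ∈ submasks k
submasks-complete [] [] [] eq = here refl
submasks-complete (x ∷ k) (false ∷ s) (y ∷ l) eq with x | eq zero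
... | zero  | refl = ∈-map⁺ _ (submasks-complete k s l (eq ∘ suc))
... | suc x | refl = ∈-++⁺ˡ (∈-map⁺ _ (submasks-complete k s l (eq ∘ suc)))
submasks-complete (x ∷ k) (true ∷ s) (y ∷ l) eq with x | eq zero
... | suc x | refl = ∈-++⁺ʳ (map _ (submasks k)) (∈-map⁺ _ (submasks-complete k s l (eq ∘ suc)))

submasks-unique : (k : Vec ℕ m) → Unique (submasks k)
submasks-unique []         = [] ∷ []
submasks-unique (zero ∷ k) = Unique.map⁺ (λ { refl → refl }) (submasks-unique k)
submasks-unique (suc x ∷ k) =
  Unique.++⁺ (Unique.map⁺ (λ { refl → refl }) (submasks-unique k))
             (Unique.map⁺ (λ { refl → refl }) (submasks-unique k))
             disjoint
  where
  disjoint : ∀ {v} → v ∈ map (λ (s , l) → false ∷ s , suc x ∷ l) (submasks k)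
             × v ∈ map (λ (s , l) → true ∷ s , x ∷ l) (submasks k) → _
  disjoint (p , q) with ∈-map⁻ _ p | ∈-map⁻ _ q
  ... | _ , _ , refl | _ , _ , ()

submasks-sum : (k : Vec ℕ m) {s : Vec Bool m} {l : Vec ℕ m} → (s , l) ∈ submasks k →
    weight s + Vec.sum l ≡ Vec.sum k
submasks-sum [] (here refl) = refl
submasks-sum (zero ∷ k) p with ∈-map⁻ _ p
... | _ , q , refl = submasks-sum k q
submasks-sum (suc x ∷ k) p with ∈-++⁻ (map _ (submasks k)) p
... | inj₁ p′ with ∈-map⁻ _ p′
... | (s , l) , q , refl = begin
  weight s + (suc x + Vec.sum l)
    ≡⟨ solve 3 (λ w x l → w :+ (x :+ l) := x :+ (w :+ l)) refl (weight s) (suc x) (Vec.sum l) ⟩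
  suc x + (weight s + Vec.sum l) ≡⟨ cong (suc x +_) (submasks-sum k q) ⟩
  suc x + Vec.sum k              ∎
  where
  open ≡-Reasoning
  open +-*-Solver
submasks-sum (suc x ∷ k) p | inj₂ p′ with ∈-map⁻ _ p′
... | (s , l) , q , refl = cong suc (begin
  weight s + (x + Vec.sum l)
    ≡⟨ solve 3 (λ w x l → w :+ (x :+ l) := x :+ (w :+ l)) refl (weight s) x (Vec.sum l) ⟩
  x + (weight s + Vec.sum l) ≡⟨ cong (x +_) (submasks-sum k q) ⟩
  x + Vec.sum k              ∎)
  where
  open ≡-Reasoning
  open +-*-Solver

-- Binomial sums over 0/1-vectors

absorption : ∀ n k → suc k * (suc n C suc k) ≡ suc n * (n C k)
absorption zero zero = refl
absorption zero (suc k) = *-zeroʳ (suc (suc k))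
absorption (suc n) zero = begin
  1 * (suc (suc n) C 1)             ≡⟨ cong (1 *_) (nCk+nC[k+1]≡[n+1]C[k+1] (suc n) 0) ⟨
  1 * (1 + suc n C 1)               ≡⟨ *-identityˡ _ ⟩
  1 + suc n C 1                     ≡⟨ cong suc (trans (sym (*-identityˡ _)) (absorption n 0)) ⟩
  suc (suc n) * (suc n C 0)         ∎
  where open ≡-Reasoning
absorption (suc n) (suc k) = begin
  suc (suc k) * (suc (suc n) C suc (suc k))
    ≡⟨ cong (suc (suc k) *_) (nCk+nC[k+1]≡[n+1]C[k+1] (suc n) (suc k)) ⟨
  suc (suc k) * (a + b)
    ≡⟨ solve 3 (λ k a b → (con 2 :+ k) :* (a :+ b) := a :+ ((con 1 :+ k) :* a :+ (con 2 :+ k) :* b)) refl k a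
        b ⟩
  a + (suc k * a + suc (suc k) * b)
    ≡⟨ cong (a +_) (cong₂ _+_ (absorption n k) (absorption n (suc k))) ⟩
  a + (suc n * c + suc n * d)               ≡⟨ cong (a +_) (*-distribˡ-+ (suc n) c d) ⟨
  a + suc n * (c + d)                       ≡⟨ cong (λ z → a + suc n * z) (nCk+nC[k+1]≡[n+1]C[k+1] n k) ⟩
  suc (suc n) * a                           ∎
  where
  open ≡-Reasoning
  open +-*-Solver
  a = suc n C suc k
  b = suc n C suc (suc k)
  c = n C k
  d = n C suc k

∑ : List A → (A → ℕ) → ℕ
∑ xs f = sum (map f xs)

∑-++ : (xs ys : List A) (f : A → ℕ) → ∑ (xs ++ ys) f ≡ ∑ xs f + ∑ ys f
∑-++ xs ys f = trans (cong sum (map-++ f xs ys)) (sum-++ (map f xs) (map f ys))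

∑-map : (g : A → B) (xs : List A) (f : B → ℕ) → ∑ (map g xs) f ≡ ∑ xs (f ∘ g)
∑-map g xs f = cong sum (sym (map-∘ xs))

∑-cong : (xs : List A) {f g : A → ℕ} → (∀ x → f x ≡ g x) → ∑ xs f ≡ ∑ xs g
∑-cong xs eq = cong sum (map-cong eq xs)

∑-cong-∈ : (xs : List A) {f g : A → ℕ} → (∀ {x} → x ∈ xs → f x ≡ g x) → ∑ xs f ≡ ∑ xs g
∑-cong-∈ xs eq = cong sum (map-cong-local (All.tabulate eq))

∑-distrib-+ : (xs : List A) (f g : A → ℕ) → ∑ xs (λ x → f x + g x) ≡ ∑ xs f + ∑ xs g
∑-distrib-+ []       f g = refl
∑-distrib-+ (x ∷ xs) f g = trans (cong (f x + g x +_) (∑-distrib-+ xs f g))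
  (solve 4 (λ a b c d → (a :+ b) :+ (c :+ d) := (a :+ c) :+ (b :+ d)) refl (f x) (g x) (∑ xs f) (∑ xs g))
  where open +-*-Solver

*-distribˡ-∑ : (c : ℕ) (xs : List A) (f : A → ℕ) → c * ∑ xs f ≡ ∑ xs (λ x → c * f x)
*-distribˡ-∑ c []       f = *-zeroʳ c
*-distribˡ-∑ c (x ∷ xs) f = trans (*-distribˡ-+ c (f x) (∑ xs f)) (cong (c * f x +_) (*-distribˡ-∑ c xs f))

length-concatMap : (f : A → List B) (xs : List A) → length (concatMap f xs) ≡ ∑ xs (length ∘ f)
length-concatMap f []       = refl
length-concatMap f (x ∷ xs) = trans (length-++ (f x)) (cong (length (f x) +_) (length-concatMap f xs))

-- Choose a k_i-subset of an (n+1)-set for every i and single out one element: `s` records which of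
-- the subsets contain it, `l` the sizes of what remains. Formally this is Pascal's rule in each
-- coordinate.
∑-binomials : ∀ n (k : Vec ℕ m) → ∑ (submasks k) (λ (s , l) → binomials n l) ≡ binomials (suc n) k
∑-binomials n [] = refl
∑-binomials n (zero ∷ k) = begin
  ∑ (map _ (submasks k)) (λ (s , l) → binomials n l)       ≡⟨ ∑-map _ (submasks k) _ ⟩
  ∑ (submasks k) (λ (s , l) → 1 * binomials n l)           ≡⟨ *-distribˡ-∑ 1 (submasks k) _ ⟨
  1 * ∑ (submasks k) (λ (s , l) → binomials n l)           ≡⟨ cong (1 *_) (∑-binomials n k) ⟩
  1 * binomials (suc n) k                                  ∎
  where open ≡-Reasoning
∑-binomials n (suc x ∷ k) = begin
  ∑ (map _ sk ++ map _ sk) f                                  ≡⟨ ∑-++ (map _ sk) (map _ sk) f ⟩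
  ∑ (map _ sk) f + ∑ (map _ sk) f                             ≡⟨ cong₂ _+_ (∑-map _ sk f) (∑-map _ sk f) ⟩
  ∑ sk (λ y → (n C suc x) * f y) + ∑ sk (λ y → (n C x) * f y)
    ≡⟨ cong₂ _+_ (*-distribˡ-∑ (n C suc x) sk f) (*-distribˡ-∑ (n C x) sk f) ⟨
  (n C suc x) * ∑ sk f + (n C x) * ∑ sk f
    ≡⟨ *-distribʳ-+ (∑ sk f) (n C suc x) (n C x) ⟨
  (n C suc x + n C x) * ∑ sk f
    ≡⟨ cong₂ _*_ (trans (+-comm (n C suc x) (n C x)) (nCk+nC[k+1]≡[n+1]C[k+1] n x)) (∑-binomials n k) ⟩
  (suc n C suc x) * binomials (suc n) k                         ∎
  where
  open ≡-Reasoning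
  sk = submasks k
  f : {m : ℕ} → Vec Bool m × Vec ℕ m → ℕ
  f (s , l) = binomials n l

-- Double counting in the same picture: for a fixed element the sum counts the chosen subsets that
-- contain it, and over all `suc n` elements each family contributes the total size of its subsets.
-- In the induction, Pascal's rule handles the weight of the tail and `absorption` the bit of the
-- first coordinate.
∑-weighted-binomials : ∀ n (k : Vec ℕ m) →
  suc n * ∑ (submasks k) (λ (s , l) → weight s * binomials n l) ≡ Vec.sum k * binomials (suc n) k
∑-weighted-binomials n [] = *-zeroʳ (suc n)
∑-weighted-binomials n (zero ∷ k) = begin
  suc n * ∑ (map _ sk) (λ (s , l) → weight s * binomials n l)        ≡⟨ cong (suc n *_) (∑-map _ sk _) ⟩
  suc n * ∑ sk (λ (s , l) → weight s * (1 * binomials n l))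
    ≡⟨ cong (suc n *_) (∑-cong sk (λ (s , l) → cong (weight s *_) (*-identityˡ (binomials n l)))) ⟩
  suc n * ∑ sk (λ (s , l) → weight s * binomials n l)                ≡⟨ ∑-weighted-binomials n k ⟩
  Vec.sum k * binomials (suc n) k
    ≡⟨ cong (Vec.sum k *_) (*-identityˡ (binomials (suc n) k)) ⟨
  Vec.sum k * (1 * binomials (suc n) k)                              ∎
  where
  open ≡-Reasoning
  sk = submasks k
∑-weighted-binomials n (suc x ∷ k) = begin
  suc n * ∑ (map _ sk ++ map _ sk) f
    ≡⟨ cong (suc n *_) (∑-++ (map _ sk) (map _ sk) f) ⟩
  suc n * (∑ (map _ sk) f + ∑ (map _ sk) f)
    ≡⟨ cong (suc n *_) (cong₂ _+_ (∑-map _ sk f) (∑-map _ sk f)) ⟩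
  suc n * (∑ sk (λ (s , l) → weight s * ((n C suc x) * binomials n l))
           + ∑ sk (λ (s , l) → suc (weight s) * ((n C x) * binomials n l)))
    ≡⟨ cong (suc n *_) (cong₂ _+_
         (∑-cong sk λ (s , l) →
             solve 3 (λ w c p → w :* (c :* p) := c :* (w :* p)) refl (weight s) (n C suc x) (binomials n l))
         (∑-cong sk λ (s , l) →
             solve 3 (λ w c p → (con 1 :+ w) :* (c :* p) := c :* (w :* p) :+ c :* p) refl (weight s) (n C x)
             (binomials n l))) ⟩
  suc n * (∑ sk (λ y → (n C suc x) * f y) + ∑ sk (λ y → (n C x) * f y + (n C x) * g y))
    ≡⟨ cong (λ z → suc n * (∑ sk (λ y → (n C suc x) * f y) + z)) (∑-distrib-+ sk _ _) ⟩
  suc n * (∑ sk (λ y → (n C suc x) * f y) + (∑ sk (λ y → (n C x) * f y) + ∑ sk (λ y → (n C x) * g y)))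
    ≡⟨ cong (suc n *_) (cong₂ _+_ (*-distribˡ-∑ (n C suc x) sk f)
        (cong₂ _+_ (*-distribˡ-∑ (n C x) sk f) (*-distribˡ-∑ (n C x) sk g))) ⟨
  suc n * ((n C suc x) * ∑ sk f + ((n C x) * ∑ sk f + (n C x) * ∑ sk g))
    ≡⟨ solve 5 (λ N a b F G → N :* (a :* F :+ (b :* F :+ b :* G)) := (b :+ a) :* (N :* F) :+ (N :* b) :* G)
        refl (suc n) (n C suc x) (n C x) (∑ sk f) (∑ sk g) ⟩
  (n C x + n C suc x) * (suc n * ∑ sk f) + (suc n * (n C x)) * ∑ sk g
    ≡⟨ cong₂ _+_ (cong₂ _*_ (nCk+nC[k+1]≡[n+1]C[k+1] n x) (∑-weighted-binomials n k))
        (cong₂ _*_ (sym (absorption n x)) (∑-binomials n k)) ⟩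
  (suc n C suc x) * (Vec.sum k * P) + (suc x * (suc n C suc x)) * P
    ≡⟨ solve 4 (λ c s p x → c :* (s :* p) :+ (x :* c) :* p := (x :+ s) :* (c :* p)) refl (suc n C suc x)
        (Vec.sum k) P (suc x) ⟩
  (suc x + Vec.sum k) * ((suc n C suc x) * P) ∎
  where
  open ≡-Reasoning
  open +-*-Solver
  sk = submasks k
  f g : {m : ℕ} → Vec Bool m × Vec ℕ m → ℕ
  f (s , l) = weight s * binomials n l
  g (s , l) = binomials n l
  P = binomials (suc n) k

-- Trees and forests

-- A `leaf` is an absent child, that is, an empty piece of the word; only a `node` counts towards
-- the size. The theorem uses m = r + 1.
data Tree (m : ℕ) : Set where
  leaf : Tree m
  node : Vec (Tree m) m → Tree m

isNode : Tree m → Bool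
isNode leaf     = false
isNode (node _) = true

mutual
  size : Tree m → ℕ
  size leaf      = 0
  size (node ts) = suc (sizes ts)

  sizes : Vec (Tree m) j → ℕ
  sizes []       = 0
  sizes (t ∷ ts) = size t + sizes ts

-- The positions of ts are numbered from p on; i selects one of them.
nodeAt : ℕ → ℕ → Vec (Tree m) j → ℕ
nodeAt p i []       = 0
nodeAt p i (t ∷ ts) = (if p ≡ᵇ i then toBit (isNode t) else 0) + nodeAt (suc p) i ts

mutual
  kind : ℕ → Tree m → ℕ
  kind i leaf      = 0
  kind i (node ts) = nodeAt 0 i ts + kinds i ts

  kinds : ℕ → Vec (Tree m) j → ℕ
  kinds i []       = 0
  kinds i (t ∷ ts) = kind i t + kinds i ts

nodeAt-suc : ∀ p i (ts : Vec (Tree m) j) → nodeAt (suc p) (suc i) ts ≡ nodeAt p i ts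
nodeAt-suc p i []       = refl
nodeAt-suc p i (t ∷ ts) = cong (_ +_) (nodeAt-suc (suc p) i ts)

nodeAt-zero : ∀ p (ts : Vec (Tree m) j) → nodeAt (suc p) 0 ts ≡ 0
nodeAt-zero p []       = refl
nodeAt-zero p (t ∷ ts) = nodeAt-zero (suc p) ts

nodeAt-toℕ : (ts : Vec (Tree m) j) (i : Fin j) → nodeAt 0 (toℕ i) ts ≡ toBit (lookup (Vec.map isNode ts) i)
nodeAt-toℕ (t ∷ ts) zero    = trans (cong (_ +_) (nodeAt-zero 0 ts)) (+-identityʳ _)
nodeAt-toℕ (t ∷ ts) (suc i) = trans (nodeAt-suc 0 (toℕ i) ts) (nodeAt-toℕ ts i)

sizes-++ : (ts : Vec (Tree m) j) (us : Vec (Tree m) n) → sizes (ts Vec.++ us) ≡ sizes ts + sizes us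
sizes-++ []       us = refl
sizes-++ (t ∷ ts) us =
    trans (cong (size t +_) (sizes-++ ts us)) (sym (+-assoc (size t) (sizes ts) (sizes us)))

kinds-++ : ∀ i (ts : Vec (Tree m) j) (us : Vec (Tree m) n) → kinds i (ts Vec.++ us) ≡ kinds i ts + kinds i us
kinds-++ i []       us = refl
kinds-++ i (t ∷ ts) us =
    trans (cong (kind i t +_) (kinds-++ i ts us)) (sym (+-assoc (kind i t) (kinds i ts) (kinds i us)))

-- Undoes the removal of the first root: its children had been put in front of the remaining trees.
graft : Vec (Tree m) (m + j) → Vec (Tree m) (suc j)
graft {m} ts = node (Vec.take m ts) ∷ Vec.drop m ts

graft-++ : (ts : Vec (Tree m) m) (us : Vec (Tree m) j) → graft (ts Vec.++ us) ≡ node ts ∷ us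
graft-++ {m} ts us with Vecₚ.++-injective (Vec.take m (ts Vec.++ us)) ts (Vecₚ.take++drop≡id m (ts Vec.++ us))
... | eq₁ , eq₂ = cong₂ (λ v w → node v ∷ w) eq₁ eq₂

-- Forests with n nodes, roots exactly where b is true, and lookup k i nodes having an i-th child;
-- only meaningful when weight b + sum k = n.
forests : ℕ → Vec Bool j → Vec ℕ m → List (Vec (Tree m) j)
forests n       (false ∷ b) k = map (leaf ∷_) (forests n b k)
forests zero    []          k = [] ∷ []
forests (suc n) []          k = []
forests zero    (true ∷ b)  k = []
forests (suc n) (true ∷ b)  k =
  concatMap (λ (s , l) → map graft (forests n (s Vec.++ b) l)) (submasks k)

forests-true : ∀ n (b : Vec Bool j) (k : Vec ℕ m) {v} → v ∈ forests (suc n) (true ∷ b) k →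
  ∃ λ s → ∃ λ l → ∃ λ ts → ∃ λ us →
      (s , l) ∈ submasks k × ts Vec.++ us ∈ forests n (s Vec.++ b) l × v ≡ node ts ∷ us
forests-true {m = m} n b k p with find (∈-concatMap⁻ _ {xs = submasks k} p)
... | (s , l) , q , p′ with ∈-map⁻ graft p′
... | w , r , refl with Vec.splitAt m w
... | ts , us , refl = s , l , ts , us , q , r , refl

sum≡0⇒lookup≡0 : (k : Vec ℕ m) → Vec.sum k ≡ 0 → ∀ i → lookup k i ≡ 0
sum≡0⇒lookup≡0 (zero ∷ k) eq zero    = refl
sum≡0⇒lookup≡0 (x ∷ k)    eq (suc i) = sum≡0⇒lookup≡0 k (m+n≡0⇒n≡0 x eq) i

-- Every node is either a root or a child of exactly one node, so roots and child counts add up to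
-- the number of nodes. Removing a root lowers this total by one: its present children move from the
-- child counts to the roots.
++-weight-sum : ∀ {n} (b : Vec Bool j) (k : Vec ℕ m) {s l} → weight (true ∷ b) + Vec.sum k ≡ suc n →
  (s , l) ∈ submasks k → weight (s Vec.++ b) + Vec.sum l ≡ n
++-weight-sum {n = n} b k {s} {l} h q = suc-injective (begin
  suc (weight (s Vec.++ b) + Vec.sum l)       ≡⟨ cong (λ z → suc (z + Vec.sum l)) (weight-++ s b) ⟩
  suc (weight s + weight b + Vec.sum l)
    ≡⟨ solve 3 (λ s b l → con 1 :+ (s :+ b :+ l) := con 1 :+ (b :+ (s :+ l))) refl (weight s) (weight b)
        (Vec.sum l) ⟩
  suc (weight b + (weight s + Vec.sum l))     ≡⟨ cong (λ z → suc (weight b + z)) (submasks-sum k q) ⟩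
  suc (weight b + Vec.sum k)                  ≡⟨ h ⟩
  suc n                                       ∎)
  where
  open ≡-Reasoning
  open +-*-Solver

forests-sound : ∀ n (b : Vec Bool j) (k : Vec ℕ m) {v} → weight b + Vec.sum k ≡ n → v ∈ forests n b k →
  sizes v ≡ n × Vec.map isNode v ≡ b × (∀ i → kinds (toℕ i) v ≡ lookup k i)
forests-sound n (false ∷ b) k h p with ∈-map⁻ _ p
... | v , q , refl with forests-sound n b k h q
... | eq₁ , eq₂ , eq₃ = eq₁ , cong (false ∷_) eq₂ , eq₃
-- `forests zero []` does not inspect `k`; the balance `h` is what makes all counts zero here.
forests-sound zero [] k h (here refl) = refl , refl , λ i → sym (sum≡0⇒lookup≡0 k h i)
forests-sound (suc n) (true ∷ b) k h p with forests-true n b k p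
... | s , l , ts , us , q , r , refl with forests-sound n (s Vec.++ b) l (++-weight-sum b k h q) r
... | eq₁ , eq₂ , eq₃ with Vecₚ.++-injective (Vec.map isNode ts) s
    (trans (sym (Vecₚ.map-++ isNode ts us)) eq₂)
... | refl , refl = cong suc (trans (sym (sizes-++ ts us)) eq₁) , refl , λ i → begin
  nodeAt 0 (toℕ i) ts + kinds (toℕ i) ts + kinds (toℕ i) us    ≡⟨ +-assoc (nodeAt 0 (toℕ i) ts) _ _ ⟩
  nodeAt 0 (toℕ i) ts + (kinds (toℕ i) ts + kinds (toℕ i) us)
    ≡⟨ cong₂ _+_ (nodeAt-toℕ ts i) (trans (sym (kinds-++ (toℕ i) ts us)) (eq₃ i)) ⟩
  toBit (lookup s i) + lookup l i                              ≡⟨ submasks-sound k q i ⟨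
  lookup k i                                                   ∎
  where open ≡-Reasoning

forests-complete : ∀ n (b : Vec Bool j) (k : Vec ℕ m) {v} →
  sizes v ≡ n → Vec.map isNode v ≡ b → (∀ i → kinds (toℕ i) v ≡ lookup k i) → v ∈ forests n b k
forests-complete n       (false ∷ b) k {leaf ∷ v}     eq₁ refl eq₃ =
    ∈-map⁺ _ (forests-complete n b k eq₁ refl eq₃)
forests-complete zero    []          k {[]}           refl refl eq₃ = here refl
forests-complete (suc n) (true ∷ b)  k {node ts ∷ us} eq₁ refl eq₃ =
  ∈-concatMap⁺ _ {xs = submasks k}
      (lose (submasks-complete k s l decomposition)
      (subst (_∈ map graft (forests n (s Vec.++ Vec.map isNode us) l)) (graft-++ ts us)
    (∈-map⁺ graft (forests-complete n (s Vec.++ Vec.map isNode us) l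
      (trans (sizes-++ ts us) (suc-injective eq₁)) (Vecₚ.map-++ isNode ts us)
      λ i → sym (Vecₚ.lookup∘tabulate _ i)))))
  where
  open ≡-Reasoning
  -- The split of `k` is read off the tree: `s` marks the present children of the removed root, and
  -- `l` counts the children in the forest left behind.
  s = Vec.map isNode ts
  l = Vec.tabulate (λ i → kinds (toℕ i) (ts Vec.++ us))
  decomposition : ∀ i → lookup k i ≡ toBit (lookup s i) + lookup l i
  decomposition i = begin
    lookup k i                                                  ≡⟨ eq₃ i ⟨
    nodeAt 0 (toℕ i) ts + kinds (toℕ i) ts + kinds (toℕ i) us   ≡⟨ +-assoc (nodeAt 0 (toℕ i) ts) _ _ ⟩
    nodeAt 0 (toℕ i) ts + (kinds (toℕ i) ts + kinds (toℕ i) us)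
      ≡⟨ cong₂ _+_ (nodeAt-toℕ ts i) (sym (kinds-++ (toℕ i) ts us)) ⟩
    toBit (lookup s i) + kinds (toℕ i) (ts Vec.++ us)
      ≡⟨ cong (toBit (lookup s i) +_) (Vecₚ.lookup∘tabulate _ i) ⟨
    toBit (lookup s i) + lookup l i                             ∎

concatMap-unique : (f : A → List B) {xs : List A} → Unique xs → (∀ {x} → x ∈ xs → Unique (f x)) →
  (∀ {x y z} → x ∈ xs → y ∈ xs → z ∈ f x → z ∈ f y → x ≡ y) → Unique (concatMap f xs)
concatMap-unique f []         u inj = []
concatMap-unique f {x ∷ xs} (x∉ ∷ xs!) u inj =
  Unique.++⁺ (u (here refl)) (concatMap-unique f xs! (u ∘ there) (λ p q → inj (there p) (there q))) disjoint
  where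
  disjoint : ∀ {z} → z ∈ f x × z ∈ concatMap f xs → _
  disjoint (p , q) with find (∈-concatMap⁻ f {xs = xs} q)
  ... | y , y∈ , z∈ = All.lookup x∉ y∈ (inj (here refl) (there y∈) p z∈)

lookup-ext : {k l : Vec A n} → (∀ i → lookup k i ≡ lookup l i) → k ≡ l
lookup-ext {k = k} {l} eq =
    trans (sym (Vecₚ.tabulate∘lookup k)) (trans (Vecₚ.tabulate-cong eq) (Vecₚ.tabulate∘lookup l))

graft-injective : {v w : Vec (Tree m) (m + j)} → graft v ≡ graft w → v ≡ w
graft-injective {m} {v = v} {w} eq with Vec.splitAt m v | Vec.splitAt m w
graft-injective refl | ts , us , refl | _ , _ , refl = refl

-- Once the graft is undone, `forests-sound` reads both the mask and the counts off the forest, so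
-- distinct members of `submasks k` contribute disjoint lists.
forests-unique : ∀ n (b : Vec Bool j) (k : Vec ℕ m) → weight b + Vec.sum k ≡ n → Unique (forests n b k)
forests-unique n       (false ∷ b) k h = Unique.map⁺ (λ { refl → refl }) (forests-unique n b k h)
forests-unique zero    []          k h = [] ∷ []
forests-unique (suc n) []          k h = []
forests-unique (suc n) (true ∷ b)  k h = concatMap-unique _ (submasks-unique k)
  (λ {(s , l)} q → Unique.map⁺ graft-injective (forests-unique n (s Vec.++ b) l (++-weight-sum b k h q)))
  determined
  where
  determined : ∀ {x y z} → x ∈ submasks k → y ∈ submasks k →
    z ∈ map graft (forests n (proj₁ x Vec.++ b) (proj₂ x)) →
        z ∈ map graft (forests n (proj₁ y Vec.++ b) (proj₂ y)) → x ≡ y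
  determined {s , l} {s′ , l′} q q′ p p′ with ∈-map⁻ graft p | ∈-map⁻ graft p′
  ... | v , r , refl | w , r′ , eq with graft-injective {v = v} {w} eq
  ... | refl with forests-sound n (s Vec.++ b) l (++-weight-sum b k h q) r | forests-sound n (s′ Vec.++ b) l′
      (++-weight-sum b k h q′) r′
  ... | _ , eq₂ , eq₃ | _ , eq₂′ , eq₃′ =
    cong₂ _,_ (proj₁ (Vecₚ.++-injective s s′ (trans (sym eq₂) eq₂′)))
              (lookup-ext (λ i → trans (sym (eq₃ i)) (eq₃′ i)))

-- The number of forests

submasks-sum≡0 : (k : Vec ℕ m) → Vec.sum k ≡ 0 → submasks k ≡ (replicate m false , k) ∷ []
submasks-sum≡0 []         h = refl
submasks-sum≡0 (zero ∷ k) h rewrite submasks-sum≡0 k h = refl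

binomials-sum≡0 : ∀ n (k : Vec ℕ m) → Vec.sum k ≡ 0 → binomials n k ≡ 1
binomials-sum≡0 n []         h = refl
binomials-sum≡0 n (zero ∷ k) h = trans (*-identityˡ _) (binomials-sum≡0 n k h)

length-forests-zero : (b : Vec Bool j) (k : Vec ℕ m) → weight b ≡ 0 → length (forests 0 b k) ≡ 1
length-forests-zero []          k h = refl
length-forests-zero (false ∷ b) k h = trans (length-map (leaf ∷_) (forests 0 b k)) (length-forests-zero b k h)

-- Removing the first root gives a recursion for N · length, and the common factor N - 1 cancels;
-- for N = 1 that factor vanishes, so this case is computed directly.
length-forests : ∀ n (b : Vec Bool j) (k : Vec ℕ m) → weight b + Vec.sum k ≡ n →
  n * length (forests n b k) ≡ weight b * binomials n k
length-forests n (false ∷ b) k h =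
    trans (cong (n *_) (length-map (leaf ∷_) (forests n b k))) (length-forests n b k h)
length-forests zero    [] k h = refl
length-forests (suc n) [] k h = *-zeroʳ (suc n)
length-forests {m = m} (suc zero) (true ∷ b) k h = begin
  1 * length (forests 1 (true ∷ b) k)                            ≡⟨ *-identityˡ _ ⟩
  length (forests 1 (true ∷ b) k)                                ≡⟨ length-concatMap _ (submasks k) ⟩
  ∑ (submasks k) _
    ≡⟨ cong (λ z → ∑ z _) (submasks-sum≡0 k Σk≡0) ⟩
  length (map graft (forests 0 (replicate m false Vec.++ b) k)) + 0 ≡⟨ +-identityʳ _ ⟩
  length (map graft (forests 0 (replicate m false Vec.++ b) k))
    ≡⟨ length-map graft (forests 0 (replicate m false Vec.++ b) k) ⟩
  length (forests 0 (replicate m false Vec.++ b) k)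
    ≡⟨ length-forests-zero (replicate m false Vec.++ b) k
        (trans (weight-++ (replicate m false) b) (cong₂ _+_ (weight-replicate-false m) wb≡0)) ⟩
  1
    ≡⟨ cong₂ (λ x y → suc x * y) wb≡0 (binomials-sum≡0 1 k Σk≡0) ⟨
  suc (weight b) * binomials 1 k                                 ∎
  where
  open ≡-Reasoning
  wb≡0 = m+n≡0⇒m≡0 (weight b) (suc-injective h)
  Σk≡0 = m+n≡0⇒n≡0 (weight b) (suc-injective h)
length-forests (suc (suc n)) (true ∷ b) k h = *-cancelˡ-≡ _ _ (suc n) (begin
  suc n * (N * length (forests N (true ∷ b) k))
    ≡⟨ cong (λ z → suc n * (N * z)) (length-concatMap _ sk) ⟩
  suc n * (N * ∑ sk (λ (s , l) → length (map graft (forests (suc n) (s Vec.++ b) l))))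
    ≡⟨ solve 3 (λ n N S → n :* (N :* S) := N :* (n :* S)) refl (suc n) N (∑ sk _) ⟩
  N * (suc n * ∑ sk (λ (s , l) → length (map graft (forests (suc n) (s Vec.++ b) l))))
    -- The factor `suc n` must enter the sum, because the induction hypothesis speaks only of
    -- `suc n` times the length.
    ≡⟨ cong (N *_) (*-distribˡ-∑ (suc n) sk _) ⟩
  N * ∑ sk (λ (s , l) → suc n * length (map graft (forests (suc n) (s Vec.++ b) l)))
    ≡⟨ cong (N *_) (∑-cong-∈ sk (λ {(s , l)} q → begin
         suc n * length (map graft (forests (suc n) (s Vec.++ b) l))
           ≡⟨ cong (suc n *_) (length-map graft (forests (suc n) (s Vec.++ b) l)) ⟩
         suc n * length (forests (suc n) (s Vec.++ b) l)
           ≡⟨ length-forests (suc n) (s Vec.++ b) l (++-weight-sum b k h q) ⟩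
         weight (s Vec.++ b) * binomials (suc n) l
           ≡⟨ cong (_* binomials (suc n) l) (weight-++ s b) ⟩
         (weight s + weight b) * binomials (suc n) l
           ≡⟨ *-distribʳ-+ (binomials (suc n) l) (weight s) (weight b) ⟩
         weight s * binomials (suc n) l + weight b * binomials (suc n) l ∎)) ⟩
  N * ∑ sk (λ (s , l) → weight s * binomials (suc n) l + weight b * binomials (suc n) l)
    ≡⟨ cong (N *_) (trans (∑-distrib-+ sk _ _) (cong (∑ sk _ +_) (sym (*-distribˡ-∑ (weight b) sk _)))) ⟩
  N * (∑ sk (λ (s , l) → weight s * binomials (suc n) l) + weight b * ∑ sk (λ (s , l) → binomials (suc n) l))
    ≡⟨ *-distribˡ-+ N (∑ sk _) _ ⟩
  N * ∑ sk (λ (s , l) → weight s * binomials (suc n) l) +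
      N * (weight b * ∑ sk (λ (s , l) → binomials (suc n) l))
    ≡⟨ cong₂ (λ x y → x + N * (weight b * y)) (∑-weighted-binomials (suc n) k) (∑-binomials (suc n) k) ⟩
  Vec.sum k * P + N * (weight b * P)
    -- Writing `N` as `suc (weight b + Vec.sum k)` lets `weight b + Vec.sum k` factor out of the
    -- whole expression, and that is the `suc n` to be cancelled.
    ≡⟨ cong (λ z → Vec.sum k * P + z * (weight b * P)) h ⟨
  Vec.sum k * P + suc (weight b + Vec.sum k) * (weight b * P)
    ≡⟨ solve 3 (λ K w P → K :* P :+ (con 1 :+ (w :+ K)) :* (w :* P) := (w :+ K) :* ((con 1 :+ w) :* P)) refl
        (Vec.sum k) (weight b) P ⟩
  (weight b + Vec.sum k) * (suc (weight b) * P)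
    ≡⟨ cong (_* (suc (weight b) * P)) (suc-injective h) ⟩
  suc n * (suc (weight b) * P) ∎)
  where
  open ≡-Reasoning
  open +-*-Solver
  N  = suc (suc n)
  sk = submasks k
  P  = binomials N k

-- Words cut at a letter

occ-here : ∀ a w → occ a (a ∷ w) ≡ suc (occ a w)
occ-here a w = cong length (filter-accept (_≟ a) refl)

occ-there : ∀ {a x} w → x ≢ a → occ a (x ∷ w) ≡ occ a w
occ-there {a} w x≢a = cong length (filter-reject (_≟ a) x≢a)

occ-++ : ∀ a u v → occ a (u ++ v) ≡ occ a u + occ a v
occ-++ a u v = trans (cong length (filter-++ (_≟ a) u v)) (length-++ (filter (_≟ a) u))

-- Reversed appending enters because `descGo` pushes the letters that it has passed onto `seen`.
occ-ʳ++ : ∀ a u v → occ a (u ʳ++ v) ≡ occ a u + occ a v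
occ-ʳ++ a []      v = refl
occ-ʳ++ a (x ∷ u) v with x ≟ a
... | yes refl = begin
  occ a (u ʳ++ (a ∷ v))     ≡⟨ occ-ʳ++ a u (a ∷ v) ⟩
  occ a u + occ a (a ∷ v)   ≡⟨ cong (occ a u +_) (occ-here a v) ⟩
  occ a u + suc (occ a v)   ≡⟨ +-suc (occ a u) (occ a v) ⟩
  suc (occ a u) + occ a v   ≡⟨ cong (_+ occ a v) (occ-here a u) ⟨
  occ a (a ∷ u) + occ a v   ∎
  where open ≡-Reasoning
... | no x≢a = begin
  occ a (u ʳ++ (x ∷ v))     ≡⟨ occ-ʳ++ a u (x ∷ v) ⟩
  occ a u + occ a (x ∷ v)   ≡⟨ cong₂ _+_ (sym (occ-there u x≢a)) (occ-there v x≢a) ⟩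
  occ a (x ∷ u) + occ a v   ∎
  where open ≡-Reasoning

occ-∉ : ∀ {a w} → All (_≢ a) w → occ a w ≡ 0
occ-∉ []                  = refl
occ-∉ {w = x ∷ w} (p ∷ q) = trans (occ-there w p) (occ-∉ q)

occ-∈ : ∀ {a w} → a ∈ w → 1 ≤ occ a w
occ-∈ {a} {w} a∈w = ∈-length (∈-filter⁺ (_≟ a) a∈w refl)

-- With a separator before every piece the recursion is uniform. Since `prefixed M (p ∷ ps)` is
-- definitionally `M ∷ joinBy M (p ∷ ps)`, facts about `joinBy` follow by dropping the first letter.
prefixed : ℕ → List Word → Word
prefixed M []       = []
prefixed M (p ∷ ps) = M ∷ p ++ prefixed M ps

joinBy : ℕ → List Word → Word
joinBy M []       = []
joinBy M (p ∷ ps) = p ++ prefixed M ps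

prefixed-All : ∀ {P : ℕ → Set} {M} → P M → ∀ {ps} → All (All P) ps → All P (prefixed M ps)
prefixed-All PM []         = []
prefixed-All PM (Pp ∷ Pps) = PM ∷ Allₚ.++⁺ Pp (prefixed-All PM Pps)

joinBy-All : ∀ {P : ℕ → Set} {M} → P M → ∀ {ps} → All (All P) ps → All P (joinBy M ps)
joinBy-All PM []         = []
joinBy-All PM (Pp ∷ Pps) = Allₚ.++⁺ Pp (prefixed-All PM Pps)

length-prefixed : ∀ M ps → length (prefixed M ps) ≡ length ps + length (concat ps)
length-prefixed M []       = refl
length-prefixed M (p ∷ ps) = cong suc (begin
  length (p ++ prefixed M ps)                ≡⟨ length-++ p ⟩
  length p + length (prefixed M ps)          ≡⟨ cong (length p +_) (length-prefixed M ps) ⟩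
  length p + (length ps + length (concat ps))
    ≡⟨ solve 3 (λ a b c → a :+ (b :+ c) := b :+ (a :+ c)) refl (length p) (length ps) _ ⟩
  length ps + (length p + length (concat ps)) ≡⟨ cong (length ps +_) (length-++ p) ⟨
  length ps + length (p ++ concat ps)        ∎)
  where
  open ≡-Reasoning
  open +-*-Solver

length-joinBy : ∀ M p ps → length (joinBy M (p ∷ ps)) ≡ length ps + length (concat (p ∷ ps))
length-joinBy M p ps = suc-injective (length-prefixed M (p ∷ ps))

occ-prefixed : ∀ M ps → occ M (prefixed M ps) ≡ length ps + occ M (concat ps)
occ-prefixed M []       = refl
occ-prefixed M (p ∷ ps) = trans (occ-here M (p ++ prefixed M ps)) (cong suc (begin
  occ M (p ++ prefixed M ps)                ≡⟨ occ-++ M p _ ⟩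
  occ M p + occ M (prefixed M ps)           ≡⟨ cong (occ M p +_) (occ-prefixed M ps) ⟩
  occ M p + (length ps + occ M (concat ps))
    ≡⟨ solve 3 (λ a b c → a :+ (b :+ c) := b :+ (a :+ c)) refl (occ M p) (length ps) _ ⟩
  length ps + (occ M p + occ M (concat ps)) ≡⟨ cong (length ps +_) (occ-++ M p _) ⟨
  length ps + occ M (p ++ concat ps)        ∎))
  where
  open ≡-Reasoning
  open +-*-Solver

occ-joinBy : ∀ M p ps → occ M (joinBy M (p ∷ ps)) ≡ length ps + occ M (concat (p ∷ ps))
occ-joinBy M p ps = suc-injective (trans (sym (occ-here M (joinBy M (p ∷ ps)))) (occ-prefixed M (p ∷ ps)))

occ-prefixed-≢ : ∀ {a M} → M ≢ a → ∀ ps → occ a (prefixed M ps) ≡ occ a (concat ps)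
occ-prefixed-≢ M≢a []       = refl
occ-prefixed-≢ {a} {M} M≢a (p ∷ ps) = begin
  occ a (M ∷ p ++ prefixed M ps)   ≡⟨ occ-there (p ++ prefixed M ps) M≢a ⟩
  occ a (p ++ prefixed M ps)       ≡⟨ occ-++ a p _ ⟩
  occ a p + occ a (prefixed M ps)  ≡⟨ cong (occ a p +_) (occ-prefixed-≢ M≢a ps) ⟩
  occ a p + occ a (concat ps)      ≡⟨ occ-++ a p _ ⟨
  occ a (p ++ concat ps)           ∎
  where open ≡-Reasoning

occ-joinBy-≢ : ∀ {a M} → M ≢ a → ∀ ps → occ a (joinBy M ps) ≡ occ a (concat ps)
occ-joinBy-≢ M≢a []       = refl
occ-joinBy-≢ {a} {M} M≢a (p ∷ ps) =
    trans (sym (occ-there (joinBy M (p ∷ ps)) M≢a)) (occ-prefixed-≢ M≢a (p ∷ ps))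

splitOn-∷≢ : ∀ M x w {p ps} → x ≢ M → splitOn M w ≡ p ∷ ps → splitOn M (x ∷ w) ≡ (x ∷ p) ∷ ps
splitOn-∷≢ M x w x≢M eq rewrite eq | dec-false (x ≟ M) x≢M = refl

splitOn-∷≡ : ∀ M w {p ps} → splitOn M w ≡ p ∷ ps → splitOn M (M ∷ w) ≡ [] ∷ p ∷ ps
splitOn-∷≡ M w eq rewrite eq | dec-true (M ≟ M) refl = refl

splitOn-joinBy : ∀ M p ps → All (All (_≢ M)) (p ∷ ps) → splitOn M (joinBy M (p ∷ ps)) ≡ p ∷ ps
splitOn-joinBy M []      []       _                = refl
splitOn-joinBy M []      (q ∷ ps) (_ ∷ h)          =
    splitOn-∷≡ M (joinBy M (q ∷ ps)) (splitOn-joinBy M q ps h)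
splitOn-joinBy M (x ∷ p) ps       ((x≢M ∷ hp) ∷ h) =
    splitOn-∷≢ M x (joinBy M (p ∷ ps)) x≢M (splitOn-joinBy M p ps (hp ∷ h))

splitOn-spec : ∀ M w → ∃₂ λ p ps → splitOn M w ≡ p ∷ ps × joinBy M (p ∷ ps) ≡ w × All (All (_≢ M)) (p ∷ ps)
splitOn-spec M []      = [] , [] , refl , refl , [] ∷ []
splitOn-spec M (x ∷ w) with x ≟ M
... | yes refl = let p , ps , split , join , h = splitOn-spec M w in
  [] , p ∷ ps , splitOn-∷≡ M w split , cong (M ∷_) join , [] ∷ h
... | no x≢M = let p , ps , split , join , h = splitOn-spec M w in
  x ∷ p , ps , splitOn-∷≢ M x w x≢M split , cong (x ∷_) join , (x≢M ∷ All.head h) ∷ All.tail h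

maxLetter-≤ : ∀ {M w} → All (_≤ M) w → maxLetter w ≤ M
maxLetter-≤ []      = z≤n
maxLetter-≤ (p ∷ h) = ⊔-lub p (maxLetter-≤ h)

≤-maxLetter : ∀ {x w} → x ∈ w → x ≤ maxLetter w
≤-maxLetter {w = y ∷ w} (here refl) = m≤m⊔n y (maxLetter w)
≤-maxLetter {w = y ∷ w} (there x∈w) = ≤-trans (≤-maxLetter x∈w) (m≤n⊔m y (maxLetter w))

maxLetter-∈ : ∀ x w → maxLetter (x ∷ w) ∈ x ∷ w
maxLetter-∈ x []      = here (⊔-identityʳ x)
maxLetter-∈ x (y ∷ w) with ⊔-sel x (maxLetter (y ∷ w))
... | inj₁ eq = here eq
... | inj₂ eq = there (subst (_∈ y ∷ w) (sym eq) (maxLetter-∈ y w))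

-- The largest letter does occur, so at least one separator drops out and the pieces together are
-- shorter than the word: fuel for the word suffices for its pieces. The number of copies fixes the
-- number of pieces, which decoding needs.
splitAtMax : ∀ x w → let M = maxLetter (x ∷ w) in
  ∃₂ λ p ps → splitOn M (x ∷ w) ≡ p ∷ ps × joinBy M (p ∷ ps) ≡ x ∷ w
    × occ M (x ∷ w) ≡ length ps × length (concat (p ∷ ps)) ≤ length w
splitAtMax x w with splitOn-spec (maxLetter (x ∷ w)) (x ∷ w)
... | p , ps , split , join , h = p , ps , split , join , count , s≤s⁻¹ (begin
  suc (length (concat (p ∷ ps)))         ≤⟨ +-monoˡ-≤ _ (subst (1 ≤_) count (occ-∈ (maxLetter-∈ x w))) ⟩
  length ps + length (concat (p ∷ ps))   ≡⟨ length-joinBy M p ps ⟨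
  length (joinBy M (p ∷ ps))             ≡⟨ cong length join ⟩
  suc (length w)                         ∎)
  where
  open ≤-Reasoning
  M = maxLetter (x ∷ w)
  count : occ M (x ∷ w) ≡ length ps
  count = trans (cong (occ M) (sym join)) (trans (occ-joinBy M p ps)
            (trans (cong (length ps +_) (occ-∉ (Allₚ.concat⁺ h))) (+-identityʳ _)))

-- Intervals and the letters kept by sorting

-- The identity permutation with an offset, so that the sorted images of the pieces have the same
-- form as that of the whole word.
interval : ℕ → ℕ → Word
interval o zero    = []
interval o (suc n) = suc o ∷ interval (suc o) n

interval-++ : ∀ o m n → interval o m ++ interval (o + m) n ≡ interval o (m + n)
interval-++ o zero    n = cong (λ z → interval z n) (+-identityʳ o)
interval-++ o (suc m) n =
    cong (suc o ∷_) (trans (cong (λ z → interval (suc o) m ++ interval z n) (+-suc o m))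
    (interval-++ (suc o) m n))

interval-∷ʳ : ∀ o n → interval o n ∷ʳ (o + suc n) ≡ interval o (suc n)
interval-∷ʳ o n = begin
  interval o n ∷ʳ (o + suc n)        ≡⟨ cong (interval o n ∷ʳ_) (+-suc o n) ⟩
  interval o n ++ interval (o + n) 1 ≡⟨ interval-++ o n 1 ⟩
  interval o (n + 1)                 ≡⟨ cong (interval o) (+-comm n 1) ⟩
  interval o (suc n)                 ∎
  where open ≡-Reasoning

interval-split : ∀ u v o n → u ++ v ≡ interval o n →
  ∃₂ λ a b → a + b ≡ n × u ≡ interval o a × v ≡ interval (o + a) b
interval-split []      v o n eq =
    0 , n , refl , refl , trans eq (cong (λ z → interval z n) (sym (+-identityʳ o)))
interval-split (x ∷ u) v o (suc n) eq with ∷-injective eq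
... | refl , eq′ with interval-split u v (suc o) n eq′
... | a , b , refl , refl , refl = suc a , b , refl , refl , cong (λ z → interval z b) (sym (+-suc o a))

applyUpTo-interval : ∀ (f : ℕ → ℕ) o n → (∀ i → f i ≡ suc (o + i)) → applyUpTo f n ≡ interval o n
applyUpTo-interval f o zero    eq = refl
applyUpTo-interval f o (suc n) eq = cong₂ _∷_ (trans (eq 0) (cong suc (+-identityʳ o)))
  (applyUpTo-interval (f ∘ suc) (suc o) n (λ i → trans (eq (suc i)) (cong suc (+-suc o i))))

idPerm-interval : ∀ n → idPerm n ≡ interval 0 n
idPerm-interval n = applyUpTo-interval suc 0 n (λ _ → refl)

InRange : ℕ → ℕ → ℕ → Set
InRange o n x = o < x × x ≤ o + n

interval-range : ∀ o n → All (InRange o n) (interval o n)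
interval-range o zero    = []
interval-range o (suc n) = (≤-refl , ≤-trans (s≤s (m≤m+n o n)) (≤-reflexive (sym (+-suc o n))))
  ∷ All.map (λ (p , q) → <-trans (n<1+n o) p , ≤-trans q (≤-reflexive (sym (+-suc o n))))
      (interval-range (suc o) n)

-- Stated through equations because for `word o (node ts)` the first letter, the maximum and the
-- split are known only propositionally.
stackFuel-step : ∀ f {w M ps} → ∃₂ (λ x v → w ≡ x ∷ v) → maxLetter w ≡ M → splitOn M w ≡ ps →
  stackFuel (suc f) w ≡ concatMap (stackFuel f) ps ∷ʳ M
stackFuel-step f (_ , _ , refl) refl refl = refl

mutual
  -- Every letter either is the maximum, which is appended, or lies in a piece, so sorting with
  -- enough fuel loses none. Decoding uses this to keep the letters of one interval out of the
  -- pieces that sort to another.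
  stackFuel-occ : ∀ f w a → length w ≤ f → occ a (stackFuel f w) ≡ 0 → occ a w ≡ 0
  stackFuel-occ f       []      a h eq = refl
  stackFuel-occ (suc f) (x ∷ w) a h eq with splitAtMax x w
  ... | p , ps , split , join , count , short = begin
    occ a (x ∷ w)              ≡⟨ cong (occ a) join ⟨
    occ a (joinBy M (p ∷ ps))  ≡⟨ occ-joinBy-≢ M≢a (p ∷ ps) ⟩
    occ a (concat (p ∷ ps))
      ≡⟨ concatMap-stackFuel-occ f (p ∷ ps) a (≤-trans short (s≤s⁻¹ h)) (m+n≡0⇒m≡0 _ eq′) ⟩
    0                          ∎
    where
    open ≡-Reasoning
    M = maxLetter (x ∷ w)
    eq′ : occ a (concatMap (stackFuel f) (p ∷ ps)) + occ a [ M ] ≡ 0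
    eq′ = trans (sym (occ-++ a (concatMap (stackFuel f) (p ∷ ps)) [ M ]))
        (trans (cong (occ a) (sym (stackFuel-step f (x , w , refl) refl split))) eq)
    M≢a : M ≢ a
    M≢a M≡a = 1+n≢0 (trans (sym (occ-here a []))
        (trans (cong (λ z → occ a [ z ]) (sym M≡a))
        (m+n≡0⇒n≡0 (occ a (concatMap (stackFuel f) (p ∷ ps))) eq′)))

  concatMap-stackFuel-occ : ∀ f ps a → length (concat ps) ≤ f → occ a (concatMap (stackFuel f) ps) ≡ 0 →
      occ a (concat ps) ≡ 0
  concatMap-stackFuel-occ f []       a h eq = refl
  concatMap-stackFuel-occ f (p ∷ ps) a h eq = trans (occ-++ a p (concat ps)) (cong₂ _+_
    (stackFuel-occ f p a (m+n≤o⇒m≤o (length p) h′) (m+n≡0⇒m≡0 _ eq′))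
    (concatMap-stackFuel-occ f ps a (m+n≤o⇒n≤o (length p) h′) (m+n≡0⇒n≡0 (occ a (stackFuel f p)) eq′)))
    where
    h′ : length p + length (concat ps) ≤ f
    h′ = subst (_≤ f) (length-++ p) h
    eq′ : occ a (stackFuel f p) + occ a (concatMap (stackFuel f) ps) ≡ 0
    eq′ = trans (sym (occ-++ a (stackFuel f p) _)) eq

-- Words of trees

mutual
  -- Postorder labelling: the children take consecutive intervals from left to right above `o`, and
  -- the root takes the next number, its copies separating the words of the children.
  word : ℕ → Tree m → Word
  word o leaf      = []
  word o (node ts) = joinBy (o + suc (sizes ts)) (pieces o ts)

  pieces : ℕ → Vec (Tree m) j → List Word
  pieces o []       = []
  pieces o (t ∷ ts) = word o t ∷ pieces (o + size t) ts

length-pieces : ∀ o (ts : Vec (Tree m) j) → length (pieces o ts) ≡ j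
length-pieces o []       = refl
length-pieces o (t ∷ ts) = cong suc (length-pieces (o + size t) ts)

InRange-mono : ∀ {o n o′ n′ x} → o′ ≤ o → o + n ≤ o′ + n′ → InRange o n x → InRange o′ n′ x
InRange-mono p q (r , s) = ≤-<-trans p r , ≤-trans s q

<⇒InRange-disjoint : ∀ {o n x y} → InRange o n x → o + n < y → y ≢ x
<⇒InRange-disjoint (_ , x≤) <y refl = <-irrefl refl (≤-<-trans x≤ <y)

InRange-last : ∀ o n → InRange o (suc n) (o + suc n)
InRange-last o n = m<m+n o (s≤s z≤n) , ≤-refl

InRange-⊆ˡ : ∀ o (a b : ℕ) {x} → InRange o a x → InRange o (a + b) x
InRange-⊆ˡ o a b = InRange-mono ≤-refl (+-monoʳ-≤ o (m≤m+n a b))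

InRange-⊆ʳ : ∀ o (a b : ℕ) {x} → InRange (o + a) b x → InRange o (a + b) x
InRange-⊆ʳ o a b = InRange-mono (m≤m+n o a) (≤-reflexive (+-assoc o a b))

InRange-suc : ∀ o n {x} → InRange o n x → InRange o (suc n) x
InRange-suc o n = InRange-mono ≤-refl (+-monoʳ-≤ o (n≤1+n n))

mutual
  word-range : ∀ o (t : Tree m) → All (InRange o (size t)) (word o t)
  word-range o leaf      = []
  word-range o (node ts) =
      joinBy-All (InRange-last o (sizes ts))
      (All.map (All.map (InRange-suc o (sizes ts))) (pieces-range o ts))

  pieces-range : ∀ o (ts : Vec (Tree m) j) → All (All (InRange o (sizes ts))) (pieces o ts)
  pieces-range o []       = []
  pieces-range o (t ∷ ts) = All.map (InRange-⊆ˡ o (size t) (sizes ts)) (word-range o t)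
    ∷ All.map (All.map (InRange-⊆ʳ o (size t) (sizes ts))) (pieces-range (o + size t) ts)

pieces-≢ : ∀ o (ts : Vec (Tree m) j) {M} → o + sizes ts < M → All (All (_≢ M)) (pieces o ts)
pieces-≢ o ts <M = All.map (All.map (λ (_ , x≤) → <⇒≢ (≤-<-trans x≤ <M))) (pieces-range o ts)

o+n<o+1+n : ∀ o n → o + n < o + suc n
o+n<o+1+n o n = +-monoʳ-< o (n<1+n n)

occ-pieces-∉ : ∀ o (ts : Vec (Tree m) j) {a} → o + sizes ts < a → occ a (concat (pieces o ts)) ≡ 0
occ-pieces-∉ o ts h = occ-∉ (Allₚ.concat⁺ (pieces-≢ o ts h))

occ-∉-range : ∀ {o n w a} → All (InRange o n) w → a ≤ o → occ a w ≡ 0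
occ-∉-range h a≤o = occ-∉ (All.map (λ (o< , _) → >⇒≢ (≤-<-trans a≤o o<)) h)

occ-word-∉ : ∀ o (t : Tree m) {a} → o + size t < a → occ a (word o t) ≡ 0
occ-word-∉ o t h = occ-∉ (All.map (λ (_ , x≤) → <⇒≢ (≤-<-trans x≤ h)) (word-range o t))

-- `suc m` pieces leave `m` gaps, each holding one copy of the root's letter; every other letter in
-- range has all its copies inside the pieces.
word-node-occ : ∀ o (ts : Vec (Tree (suc m)) (suc m)) {a} →
    (InRange o (sizes ts) a → occ a (concat (pieces o ts)) ≡ m) →
  InRange o (suc (sizes ts)) a → occ a (word o (node ts)) ≡ m
word-node-occ {m} o ts@(t ∷ us) {a} ih (o<a , a≤) with o + suc (sizes ts) ≟ a
... | yes refl = begin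
  occ M (joinBy M (pieces o ts))                                     ≡⟨ occ-joinBy M (word o t) _ ⟩
  length (pieces (o + size t) us) + occ M (concat (pieces o ts))
    ≡⟨ cong₂ _+_ (length-pieces (o + size t) us) (occ-pieces-∉ o ts (o+n<o+1+n o (sizes ts))) ⟩
  m + 0                                                              ≡⟨ +-identityʳ m ⟩
  m                                                                  ∎
  where
  open ≡-Reasoning
  M = o + suc (sizes ts)
... | no M≢a = trans (occ-joinBy-≢ M≢a (pieces o ts))
  (ih (o<a , s≤s⁻¹ (≤-trans (≤∧≢⇒< a≤ (≢-sym M≢a)) (≤-reflexive (+-suc o (sizes ts))))))

mutual
  word-occ : ∀ o (t : Tree (suc m)) {a} → InRange o (size t) a → occ a (word o t) ≡ m
  word-occ o (node ts) r = word-node-occ o ts (pieces-occ o ts) r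
  word-occ o leaf (o<a , a≤) = contradiction (≤-trans a≤ (≤-reflexive (+-identityʳ o))) (<⇒≱ o<a)

  pieces-occ : ∀ o (ts : Vec (Tree (suc m)) j) {a} → InRange o (sizes ts) a → occ a (concat (pieces o ts)) ≡ m
  pieces-occ o [] (o<a , a≤) = contradiction (≤-trans a≤ (≤-reflexive (+-identityʳ o))) (<⇒≱ o<a)
  pieces-occ {m} o (t ∷ ts) {a} (o<a , a≤) with a ≤? o + size t
  ... | yes a≤t = begin
    occ a (word o t ++ concat (pieces (o + size t) ts))         ≡⟨ occ-++ a (word o t) _ ⟩
    occ a (word o t) + occ a (concat (pieces (o + size t) ts))
      ≡⟨ cong₂ _+_ (word-occ o t (o<a , a≤t))
          (occ-∉-range (Allₚ.concat⁺ (pieces-range (o + size t) ts)) a≤t) ⟩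
    m + 0                                                       ≡⟨ +-identityʳ m ⟩
    m                                                           ∎
    where open ≡-Reasoning
  ... | no a≰t = trans (occ-++ a (word o t) _)
    (cong₂ _+_ (occ-word-∉ o t (≰⇒> a≰t))
               (pieces-occ (o + size t) ts
                   (≰⇒> a≰t , ≤-trans a≤ (≤-reflexive (sym (+-assoc o (size t) (sizes ts)))))))

mutual
  word-length : ∀ o (t : Tree (suc m)) → length (word o t) ≡ m * size t
  word-length {m} o leaf = sym (*-zeroʳ m)
  word-length {m} o (node (t ∷ ts)) = begin
    length (joinBy M (pieces o (t ∷ ts)))
      ≡⟨ length-joinBy M (word o t) _ ⟩
    length (pieces (o + size t) ts) + length (concat (pieces o (t ∷ ts)))
      ≡⟨ cong₂ _+_ (length-pieces (o + size t) ts) (pieces-length o (t ∷ ts)) ⟩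
    m + m * sizes (t ∷ ts)
      ≡⟨ *-suc m (sizes (t ∷ ts)) ⟨
    m * suc (sizes (t ∷ ts))                                                       ∎
    where
    open ≡-Reasoning
    M = o + suc (sizes (t ∷ ts))

  pieces-length : ∀ o (ts : Vec (Tree (suc m)) j) → length (concat (pieces o ts)) ≡ m * sizes ts
  pieces-length {m} o [] = sym (*-zeroʳ m)
  pieces-length {m} o (t ∷ ts) = begin
    length (word o t ++ concat (pieces (o + size t) ts))       ≡⟨ length-++ (word o t) ⟩
    length (word o t) + length (concat (pieces (o + size t) ts))
      ≡⟨ cong₂ _+_ (word-length o t) (pieces-length (o + size t) ts) ⟩
    m * size t + m * sizes ts                                  ≡⟨ *-distribˡ-+ m (size t) (sizes ts) ⟨
    m * (size t + sizes ts)                                    ∎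
    where open ≡-Reasoning

-- The nesting condition for words of trees

any-∉ : ∀ {a u} → All (_≢ a) u → any (λ y → y ≡ᵇ a) u ≡ false
any-∉ []                    = refl
any-∉ {a} {x ∷ u} (x≢a ∷ h) = cong₂ _∨_ (dec-false (x ≟ a) x≢a) (any-∉ h)

any-++-∉ : ∀ {a} t {u} → All (_≢ a) u → any (λ y → y ≡ᵇ a) (t ++ u) ≡ any (λ y → y ≡ᵇ a) t
any-++-∉ []      h = any-∉ h
any-++-∉ (x ∷ t) h = cong (_ ∨_) (any-++-∉ t h)

okFrom-≤ : ∀ {a u} → All (_≤ a) u → okFrom a u ≡ true
okFrom-≤ []                              = refl
okFrom-≤ {a} {x ∷ u} (x≤a ∷ h) rewrite dec-true (x ≤? a) x≤a = okFrom-≤ h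

okFrom-∉ : ∀ {a u} → All (_≢ a) u → okFrom a u ≡ true
okFrom-∉ []                                                  = refl
okFrom-∉ {a} {x ∷ u} (x≢a ∷ h) rewrite any-∉ h | ∨-zeroʳ (x ≤ᵇ a) = okFrom-∉ h

okFrom-++ : ∀ {a} t {u} → okFrom a t ≡ true → All (_≢ a) u → okFrom a (t ++ u) ≡ true
okFrom-++     []      ok h = okFrom-∉ h
okFrom-++ {a} (x ∷ t) ok h rewrite any-++-∉ t h =
  cong₂ _∧_ (∧-conicalˡ ((x ≤ᵇ a) ∨ not (any (λ y → y ≡ᵇ a) t)) _ ok)
      (okFrom-++ t (∧-conicalʳ ((x ≤ᵇ a) ∨ not (any (λ y → y ≡ᵇ a) t)) _ ok) h)

-- A letter of `t` has no later copy in `u`, so nothing in `u` can stand between two copies of it.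
nested-++ : ∀ t {u} → nestedCond t ≡ true → nestedCond u ≡ true → All (λ a → All (_≢ a) u) t →
    nestedCond (t ++ u) ≡ true
nested-++ []      nt nu []      = nu
nested-++ (a ∷ t) nt nu (h ∷ d) =
  cong₂ _∧_ (okFrom-++ t (∧-conicalˡ (okFrom a t) _ nt) h) (nested-++ t (∧-conicalʳ (okFrom a t) _ nt) nu d)

word-prefixed-disjoint : ∀ o (t : Tree m) (ts : Vec (Tree m) j) {M} → o + size t + sizes ts < M →
  All (λ a → All (_≢ a) (prefixed M (pieces (o + size t) ts))) (word o t)
word-prefixed-disjoint o t ts {M} <M =
    All.map (λ r → All.map (λ >t → <⇒InRange-disjoint r >t) above) (word-range o t)
  where
  above : All (o + size t <_) (prefixed M (pieces (o + size t) ts))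
  above = prefixed-All (≤-<-trans (m≤m+n _ (sizes ts)) <M)
      (All.map (All.map proj₁) (pieces-range (o + size t) ts))

mutual
  word-nested : ∀ o (t : Tree m) → nestedCond (word o t) ≡ true
  word-nested o leaf = refl
  word-nested o (node []) = refl
  word-nested o (node (t ∷ ts)) =
      nested-++ (word o t) (word-nested o t) (prefixed-nested (o + size t) ts <M)
      (word-prefixed-disjoint o t ts <M)
    where
    <M : o + size t + sizes ts < o + suc (size t + sizes ts)
    <M = ≤-<-trans (≤-reflexive (+-assoc o (size t) (sizes ts))) (o+n<o+1+n o _)

  prefixed-nested : ∀ o (ts : Vec (Tree m) j) {M} → o + sizes ts < M →
      nestedCond (prefixed M (pieces o ts)) ≡ true
  prefixed-nested o [] <M = refl
  prefixed-nested o (t ∷ ts) {M} <M = cong₂ _∧_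
    (okFrom-≤ (joinBy-All ≤-refl
        (All.map (All.map (λ (_ , x≤) → <⇒≤ (≤-<-trans x≤ <M))) (pieces-range o (t ∷ ts)))))
    (nested-++ (word o t) (word-nested o t) (prefixed-nested (o + size t) ts <M′)
        (word-prefixed-disjoint o t ts <M′))
    where
    <M′ : o + size t + sizes ts < M
    <M′ = ≤-<-trans (≤-reflexive (+-assoc o (size t) (sizes ts))) <M

-- Sorting words of trees and recovering the trees

-- This is where r ≥ 1 enters: two or more pieces need a separator, so the root's letter appears.
-- With a single slot per node every word would be empty.
word-node-∷ : ∀ o (ts : Vec (Tree (suc (suc m))) (suc (suc m))) → ∃₂ λ x w → word o (node ts) ≡ x ∷ w
word-node-∷ o (t ∷ u ∷ ts) with word o t
... | []    = _ , _ , refl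
... | x ∷ w = _ , _ , refl

maxLetter-word : ∀ o (ts : Vec (Tree (suc (suc m))) (suc (suc m))) →
    maxLetter (word o (node ts)) ≡ o + suc (sizes ts)
maxLetter-word o ts@(t ∷ u ∷ us) = ≤-antisym
  (maxLetter-≤ (All.map proj₂ (word-range o (node ts))))
  (≤-maxLetter (∈-++⁺ʳ (word o t) (here refl)))

splitOn-word : ∀ o (ts : Vec (Tree (suc m)) (suc m)) →
    splitOn (o + suc (sizes ts)) (word o (node ts)) ≡ pieces o ts
splitOn-word o ts@(_ ∷ _) = splitOn-joinBy _ _ _ (pieces-≢ o ts (o+n<o+1+n o (sizes ts)))

length-concat-pieces< : ∀ o (ts : Vec (Tree (suc (suc m))) (suc (suc m))) →
    length (concat (pieces o ts)) < length (word o (node ts))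
length-concat-pieces< o ts@(t ∷ us@(_ ∷ _)) =
    ≤-trans (s≤s (m≤n+m _ _))
    (≤-reflexive (sym (length-joinBy (o + suc (sizes ts)) (word o t) (pieces (o + size t) us))))

mutual
  stackFuel-word : ∀ f o (t : Tree (suc (suc m))) → length (word o t) ≤ f →
      stackFuel f (word o t) ≡ interval o (size t)
  stackFuel-word zero    o leaf h = refl
  stackFuel-word (suc f) o leaf h = refl
  stackFuel-word zero    o (node ts) h = contradiction (≤-trans (length-concat-pieces< o ts) h) λ ()
  stackFuel-word (suc f) o (node ts) h = begin
    stackFuel (suc f) (word o (node ts))
      ≡⟨ stackFuel-step f (word-node-∷ o ts) (maxLetter-word o ts) (splitOn-word o ts) ⟩
    concatMap (stackFuel f) (pieces o ts) ∷ʳ (o + suc (sizes ts))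
      ≡⟨ cong (_∷ʳ (o + suc (sizes ts)))
          (concatMap-stackFuel-pieces f o ts (s≤s⁻¹ (≤-trans (length-concat-pieces< o ts) h))) ⟩
    interval o (sizes ts) ∷ʳ (o + suc (sizes ts))                   ≡⟨ interval-∷ʳ o (sizes ts) ⟩
    interval o (suc (sizes ts))                                     ∎
    where open ≡-Reasoning

  concatMap-stackFuel-pieces : ∀ f o (ts : Vec (Tree (suc (suc m))) j) → length (concat (pieces o ts)) ≤ f →
    concatMap (stackFuel f) (pieces o ts) ≡ interval o (sizes ts)
  concatMap-stackFuel-pieces f o [] h = refl
  concatMap-stackFuel-pieces f o (t ∷ ts) h = trans
    (cong₂ _++_ (stackFuel-word f o t (m+n≤o⇒m≤o (length (word o t)) h′))
                (concatMap-stackFuel-pieces f (o + size t) ts (m+n≤o⇒n≤o (length (word o t)) h′)))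
    (interval-++ o (size t) (sizes ts))
    where
    h′ : length (word o t) + length (concat (pieces (o + size t) ts)) ≤ f
    h′ = subst (_≤ f) (length-++ (word o t)) h

mutual
  -- The largest letter is that of the root, so cutting there recovers the pieces. The offset of
  -- each later piece is known once the earlier subtrees have been identified.
  word-injective : ∀ o (t u : Tree (suc (suc m))) → word o t ≡ word o u → t ≡ u
  word-injective o leaf leaf eq = refl
  word-injective o leaf (node us) eq with word-node-∷ o us
  ... | _ , _ , eq′ with trans eq eq′
  ... | ()
  word-injective o (node ts) leaf eq with word-node-∷ o ts
  ... | _ , _ , eq′ with trans (sym eq′) eq
  ... | ()
  word-injective o (node ts) (node us) eq = cong node (pieces-injective o ts us (begin
    pieces o ts                                       ≡⟨ splitOn-word o ts ⟨
    splitOn (o + suc (sizes ts)) (word o (node ts))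
      ≡⟨ cong₂ splitOn (trans (sym (maxLetter-word o ts)) (trans (cong maxLetter eq) (maxLetter-word o us)))
          eq ⟩
    splitOn (o + suc (sizes us)) (word o (node us))   ≡⟨ splitOn-word o us ⟩
    pieces o us                                       ∎))
    where open ≡-Reasoning

  pieces-injective : ∀ o (ts us : Vec (Tree (suc (suc m))) j) → pieces o ts ≡ pieces o us → ts ≡ us
  pieces-injective o []       []       eq = refl
  pieces-injective o (t ∷ ts) (u ∷ us) eq with ∷-injective eq
  ... | eq₁ , eq₂ with word-injective o t u eq₁
  ... | refl = cong (t ∷_) (pieces-injective (o + size t) ts us eq₂)

mutual
  -- Nestedness comes for free: the pieces have disjoint letters because their images under S are
  -- disjoint intervals.
  decode : ∀ f w o n → length w ≤ f → stackFuel f w ≡ interval o n → (∀ {a} → InRange o n a → occ a w ≡ m) →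
           ∃ λ (t : Tree (suc m)) → word o t ≡ w × size t ≡ n
  decode zero    []      o zero h sorted occs = leaf , refl , refl
  decode (suc f) []      o zero h sorted occs = leaf , refl , refl
  decode (suc f) (x ∷ w) o n h sorted occs with splitAtMax x w
  decode (suc f) (x ∷ w) o zero h sorted occs | p , ps , split , join , count , short
    -- A nonempty word sorts to a list ending in its maximum, which cannot be the empty interval;
    -- comparing lengths gives the contradiction.
    with () ← trans (+-comm 1 _)
        (trans (sym (length-++ (concatMap (stackFuel f) (p ∷ ps))))
        (cong length (trans (sym (stackFuel-step f (x , w , refl) refl split)) sorted)))
  decode (suc f) (x ∷ w) o (suc n) h sorted occs | p , ps , split , join , count , short
    -- Both sides are split before their last letter: this identifies the maximum as `o + suc n` and
    -- leaves the pieces sorting to `interval o n`.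
    with ∷ʳ-injective (concatMap (stackFuel f) (p ∷ ps)) (interval o n)
           (trans (sym (stackFuel-step f (x , w , refl) refl split)) (trans sorted (sym (interval-∷ʳ o n))))
  ... | sorted′ , max
    -- There is one more piece than copies of the maximum, and that letter has `m` copies by `occs`;
    -- hence `suc m` children.
    with decodePieces f (p ∷ ps) o n
        (cong suc (trans (sym count) (occs (subst (InRange o (suc n)) (sym max) (InRange-last o n)))))
           (≤-trans short (s≤s⁻¹ h)) sorted′
           (λ {a} r → trans (sym
               (occ-joinBy-≢ (λ M≡a → <⇒≢ (≤-<-trans (proj₂ r) (o+n<o+1+n o n)) (trans (sym M≡a) max))
               (p ∷ ps)))
                            (trans (cong (occ a) join) (occs (InRange-suc o n r))))
  ... | ts , eq , refl = node ts , trans (cong₂ joinBy (sym max) eq) join , refl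

  -- The copy counts are given only for the concatenation and must be localised. A letter from the
  -- interval of one image is absent from the other images, hence by `stackFuel-occ` from the other
  -- pieces, so all its copies lie in a single piece.
  decodePieces : ∀ f ps o n → length ps ≡ j → length (concat ps) ≤ f →
      concatMap (stackFuel f) ps ≡ interval o n →
    (∀ {a} → InRange o n a → occ a (concat ps) ≡ m) → ∃ λ (ts : Vec (Tree (suc m)) j) →
        pieces o ts ≡ ps × sizes ts ≡ n
  decodePieces f []       o zero refl h sorted occs = [] , refl , refl
  decodePieces {m = m} f (p ∷ ps) o n refl h sorted occs with interval-split (stackFuel f p) _ o n sorted
  ... | a , b , refl , sorted₁ , sorted₂
    with decode f p o a h₁ sorted₁ occs₁ | decodePieces f ps (o + a) b refl h₂ sorted₂ occs₂
    where
    h′ : length p + length (concat ps) ≤ f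
    h′ = subst (_≤ f) (length-++ p) h
    h₁ = m+n≤o⇒m≤o (length p) h′
    h₂ = m+n≤o⇒n≤o (length p) h′
    occs₁ : ∀ {x} → InRange o a x → occ x p ≡ m
    occs₁ {x} r = begin
      occ x p                      ≡⟨ +-identityʳ _ ⟨
      occ x p + 0
        ≡⟨ cong (occ x p +_) (concatMap-stackFuel-occ f ps x h₂
            (trans (cong (occ x) sorted₂) (occ-∉-range (interval-range (o + a) b) (proj₂ r)))) ⟨
      occ x p + occ x (concat ps)  ≡⟨ occ-++ x p (concat ps) ⟨
      occ x (p ++ concat ps)       ≡⟨ occs (InRange-⊆ˡ o a b r) ⟩
      m                            ∎
      where open ≡-Reasoning
    occs₂ : ∀ {x} → InRange (o + a) b x → occ x (concat ps) ≡ m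
    occs₂ {x} r = begin
      occ x (concat ps)
        ≡⟨ cong (_+ occ x (concat ps))
            (stackFuel-occ f p x h₁
            (trans (cong (occ x) sorted₁)
            (occ-∉ (All.map (λ (_ , y≤) → <⇒≢ (≤-<-trans y≤ (proj₁ r))) (interval-range o a))))) ⟨
      occ x p + occ x (concat ps)  ≡⟨ occ-++ x p (concat ps) ⟨
      occ x (p ++ concat ps)       ≡⟨ occs (InRange-⊆ʳ o a b r) ⟩
      m                            ∎
      where open ≡-Reasoning
  ... | t , eq₁ , refl | ts , eq₂ , refl = t ∷ ts , cong₂ _∷_ eq₁ eq₂ , refl

-- Descents

-- This and `nextSmaller` are the tests local to `descGo`, with the current letter made explicit.
prevSmaller : ℕ → Maybe ℕ → Bool
prevSmaller a nothing  = false
prevSmaller a (just p) = p <ᵇ a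

nextSmaller : ℕ → Word → Bool
nextSmaller a []      = false
nextSmaller a (b ∷ _) = b <ᵇ a

-- The invariant on what surrounds a subword: its neighbour is missing or at least `M`. It ensures
-- that an empty piece next to a copy of `M` yields no descent.
AtLeastᵖ : ℕ → Maybe ℕ → Set
AtLeastᵖ M nothing  = ⊤
AtLeastᵖ M (just p) = M ≤ p

AtLeastⁿ : ℕ → Word → Set
AtLeastⁿ M []      = ⊤
AtLeastⁿ M (b ∷ _) = M ≤ b

AtLeastᵖ-mono : ∀ {M N} p → N ≤ M → AtLeastᵖ M p → AtLeastᵖ N p
AtLeastᵖ-mono nothing  h q = tt
AtLeastᵖ-mono (just p) h q = ≤-trans h q

AtLeastⁿ-mono : ∀ {M N} w → N ≤ M → AtLeastⁿ M w → AtLeastⁿ N w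
AtLeastⁿ-mono []      h q = tt
AtLeastⁿ-mono (x ∷ w) h q = ≤-trans h q

prevSmaller-false : ∀ {M} p → AtLeastᵖ M p → prevSmaller M p ≡ false
prevSmaller-false     nothing  q = refl
prevSmaller-false {M} (just p) q = dec-false (p <? M) (≤⇒≯ q)

nextSmaller-false : ∀ {M} w → AtLeastⁿ M w → nextSmaller M w ≡ false
nextSmaller-false     []      q = refl
nextSmaller-false {M} (x ∷ w) q = dec-false (x <? M) (≤⇒≯ q)

lastOr : Maybe ℕ → Word → Maybe ℕ
lastOr prev []      = prev
lastOr prev (x ∷ w) = lastOr (just x) w

lastOr-++ : ∀ prev u v → lastOr prev (u ++ v) ≡ lastOr (lastOr prev u) v
lastOr-++ prev []      v = refl
lastOr-++ prev (x ∷ u) v = lastOr-++ (just x) u v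

lastOr-smaller : ∀ {M prev} x w → All (_< M) (x ∷ w) → prevSmaller M (lastOr prev (x ∷ w)) ≡ true
lastOr-smaller {M} x []      (x<M ∷ _) = dec-true (x <? M) x<M
lastOr-smaller     x (y ∷ w) (_ ∷ h)   = lastOr-smaller {prev = just x} y w h

word-< : ∀ o (t : Tree m) {M} → o + size t < M → All (_< M) (word o t)
word-< o t <M = All.map (λ (_ , x≤) → ≤-<-trans x≤ <M) (word-range o t)

prevSmaller-word : ∀ o (t : Tree (suc (suc m))) {M} prev → o + size t < M → AtLeastᵖ M prev →
  prevSmaller M (lastOr prev (word o t)) ≡ isNode t
prevSmaller-word o leaf      prev <M q = prevSmaller-false prev q
prevSmaller-word o (node ts) prev <M q with word o (node ts) | word-node-∷ o ts | word-< o (node ts) <M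
... | _ | x , w , refl | h = lastOr-smaller {prev = prev} x w h

nextSmaller-word : ∀ o (t : Tree (suc (suc m))) {M} rest → o + size t < M → AtLeastⁿ M rest →
  nextSmaller M (word o t ++ rest) ≡ isNode t
nextSmaller-word o leaf          rest <M q = nextSmaller-false rest q
nextSmaller-word o (node ts) {M} rest <M q with word o (node ts) | word-node-∷ o ts | word-< o (node ts) <M
... | _ | x , w , refl | x<M ∷ _ = dec-true (x <? M) x<M

-- The type 0 descent at an occurrence of a letter that has p earlier occurrences.
firstBit : ℕ → ℕ → Bool → ℕ
firstBit p i b = if (p ≡ᵇ 0) ∧ (i ≡ᵇ 0) then toBit b else 0

-- Uniform in `i`: a copy with `p` predecessors can count for type 0 only if `p` is zero, through
-- the letter before it, and for type `suc p` through the letter after it. The proof takes cases on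
-- `prev` and `u` so that the tests local to `descGo` compute.
descGo-∷ : ∀ i prev seen M u p → occ M seen ≡ p →
  descGo i prev seen (M ∷ u) ≡
    firstBit p i (prevSmaller M prev) +
        ((if suc p ≡ᵇ i then toBit (nextSmaller M u) else 0) + descGo i (just M) (M ∷ seen) u)
descGo-∷ i prev seen M u p refl =
    trans (unfold i prev u) (+-assoc (firstBit (occ M seen) i (prevSmaller M prev)) _ _)
  where
  toBit-∧ : ∀ a b → (if a ∧ b then 1 else 0) ≡ (if a then toBit b else 0)
  toBit-∧ false b     = refl
  toBit-∧ true  false = refl
  toBit-∧ true  true  = refl
  symᵇ : ∀ a b → (a ≡ᵇ b) ≡ (b ≡ᵇ a)
  symᵇ zero    zero    = refl
  symᵇ zero    (suc b) = refl
  symᵇ (suc a) zero    = refl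
  symᵇ (suc a) (suc b) = symᵇ a b
  first-zero : ∀ p b → (if (p ≡ᵇ 0) ∧ b then 1 else 0) ≡ firstBit p 0 b + 0
  first-zero zero    false = refl
  first-zero zero    true  = refl
  first-zero (suc p) b     = refl
  first-suc : ∀ p i b → firstBit p (suc i) b ≡ 0
  first-suc zero    i b = refl
  first-suc (suc p) i b = refl
  unfold : ∀ i prev u → descGo i prev seen (M ∷ u) ≡
    firstBit (occ M seen) i (prevSmaller M prev) +
        (if suc (occ M seen) ≡ᵇ i then toBit (nextSmaller M u) else 0) + descGo i (just M) (M ∷ seen) u
  unfold zero    nothing  u       = cong (_+ descGo 0 (just M) (M ∷ seen) u) (first-zero (occ M seen) false)
  unfold zero    (just p) u       =
      cong (_+ descGo 0 (just M) (M ∷ seen) u) (first-zero (occ M seen) (p <ᵇ M))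
  unfold (suc i) prev     []      =
      cong (_+ 0) (trans (toBit-∧ (occ M seen ≡ᵇ i) false)
      (cong (_+ _) (sym (first-suc (occ M seen) i (prevSmaller M prev)))))
  unfold (suc i) prev     (b ∷ u) = cong (_+ descGo (suc i) (just M) (M ∷ seen) (b ∷ u))
    (trans (toBit-∧ (occ M seen ≡ᵇ i) (b <ᵇ M))
        (cong (_+ _) (sym (first-suc (occ M seen) i (prevSmaller M prev)))))

-- Guarantees that copies are numbered from the start of the current subtree, whatever has been
-- scanned before.
Fresh : ℕ → ℕ → Word → Set
Fresh o n seen = ∀ {a} → InRange o n a → occ a seen ≡ 0

fresh-word : ∀ o (t : Tree m) n {seen} → Fresh (o + size t) n seen → Fresh (o + size t) n (word o t ʳ++ seen)
fresh-word o t n {seen} fresh {a} r@(<a , _) =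
    trans (occ-ʳ++ a (word o t) seen) (cong₂ _+_ (occ-word-∉ o t <a) (fresh r))

fresh-∷ : ∀ {o n M seen} → o + n < M → Fresh o n seen → Fresh o n (M ∷ seen)
fresh-∷ {seen = seen} <M fresh r = trans (occ-there seen (<⇒InRange-disjoint r <M)) (fresh r)

AtLeastⁿ-prefixed : ∀ M ps rest → AtLeastⁿ M rest → AtLeastⁿ M (prefixed M ps ++ rest)
AtLeastⁿ-prefixed M []      rest q = q
AtLeastⁿ-prefixed M (_ ∷ _) rest q = ≤-refl

-- The descents found in rest when the scan has already passed w.
after : ℕ → Maybe ℕ → Word → Word → Word → ℕ
after i prev seen w rest = descGo i (lastOr prev w) (w ʳ++ seen) rest

after-++ : ∀ i prev seen u v rest →
  after i prev seen (u ++ v) rest ≡ after i (lastOr prev u) (u ʳ++ seen) v rest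
after-++ i prev seen u v rest = cong₂ (λ p s → descGo i p s rest) (lastOr-++ prev u v) (++-ʳ++ u)

mutual
  -- A subtree is scanned in the middle of a longer word, so the induction runs over all contexts:
  -- `M` bounds both neighbours from below, and `after` keeps the state of the scan for what
  -- follows.
  desc-word : ∀ i prev seen o (t : Tree (suc (suc m))) M rest →
    o + size t < M → Fresh o (size t) seen → AtLeastᵖ M prev → AtLeastⁿ M rest →
    descGo i prev seen (word o t ++ rest) ≡ kind i t + after i prev seen (word o t) rest
  desc-word i prev seen o leaf M rest <M fresh pᵖ pⁿ = refl
  desc-word {m} i prev seen o (node ts@(t ∷ us@(u ∷ vs))) M rest <M fresh pᵖ pⁿ = begin
    descGo i prev seen ((word o t ++ W) ++ rest)
      ≡⟨ cong (descGo i prev seen) (++-assoc (word o t) W rest) ⟩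
    descGo i prev seen (word o t ++ (W ++ rest))
      -- For the first child the bound drops to `N`: the letter before it, if any, is still at least
      -- `M`, and `W` opens with `N` itself.
      ≡⟨ desc-word i prev seen o t N (W ++ rest) t<N
          (fresh ∘ InRange-suc o (sizes ts) ∘ InRange-⊆ˡ o (size t) (sizes us))
           (AtLeastᵖ-mono prev (<⇒≤ <M) pᵖ) ≤-refl ⟩
    kind i t + descGo i (lastOr prev (word o t)) (word o t ʳ++ seen) (W ++ rest)
      ≡⟨ cong (kind i t +_)
          (desc-prefixed i (lastOr prev (word o t)) (word o t ʳ++ seen) 0 (o + size t) u vs N rest us<N
           (fresh-word o t (sizes us) (fresh ∘ InRange-suc o (sizes ts) ∘ InRange-⊆ʳ o (size t) (sizes us)))
           (trans (occ-ʳ++ N (word o t) seen)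
               (cong₂ _+_ (occ-word-∉ o t t<N) (fresh (InRange-last o (sizes ts)))))
           (AtLeastⁿ-mono rest (<⇒≤ <M) pⁿ)) ⟩
    kind i t + (firstBit 0 i (prevSmaller N (lastOr prev (word o t))) +
        ((nodeAt 1 i us + kinds i us) + after i (lastOr prev (word o t)) (word o t ʳ++ seen) W rest))
      ≡⟨ cong₂ (λ b z → kind i t + (firstBit 0 i b + ((nodeAt 1 i us + kinds i us) + z)))
           (prevSmaller-word o t prev t<N (AtLeastᵖ-mono prev (<⇒≤ <M) pᵖ))
               (sym (after-++ i prev seen (word o t) W rest)) ⟩
    kind i t + (firstBit 0 i (isNode t) + ((nodeAt 1 i us + kinds i us) + rem))
      ≡⟨ cong (λ z → kind i t + (z + ((nodeAt 1 i us + kinds i us) + rem))) (firstBit-0 i (isNode t)) ⟩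
    kind i t + (bit + ((nodeAt 1 i us + kinds i us) + rem))
      ≡⟨ solve 5 (λ k b n ks a → k :+ (b :+ ((n :+ ks) :+ a)) := ((b :+ n) :+ (k :+ ks)) :+ a) refl (kind i t)
          bit (nodeAt 1 i us) (kinds i us) rem ⟩
    (nodeAt 0 i ts + kinds i ts) + rem ∎
    where
    open ≡-Reasoning
    open +-*-Solver
    N = o + suc (sizes ts)
    W = prefixed N (pieces (o + size t) us)
    rem = after i prev seen (word o t ++ W) rest
    bit = if 0 ≡ᵇ i then toBit (isNode t) else 0
    t<N : o + size t < N
    t<N = ≤-<-trans (+-monoʳ-≤ o (m≤m+n (size t) (sizes us))) (o+n<o+1+n o (sizes ts))
    us<N : o + size t + sizes us < N
    us<N = ≤-<-trans (≤-reflexive (+-assoc o (size t) (sizes us))) (o+n<o+1+n o (sizes ts))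
    firstBit-0 : ∀ i b → firstBit 0 i b ≡ (if 0 ≡ᵇ i then toBit b else 0)
    firstBit-0 zero    b = refl
    firstBit-0 (suc i) b = refl

  -- With `p` copies of `M` already seen, the next copy is number `suc p` and the tree behind it is
  -- child number `suc p`, child 0 standing before all copies. This is why type i and child i carry
  -- the same number.
  desc-prefixed : ∀ i prev seen p o (t : Tree (suc (suc m))) (ts : Vec (Tree (suc (suc m))) j) M rest →
    o + sizes (t ∷ ts) < M → Fresh o (sizes (t ∷ ts)) seen → occ M seen ≡ p → AtLeastⁿ M rest →
    descGo i prev seen (prefixed M (pieces o (t ∷ ts)) ++ rest) ≡
      firstBit p i (prevSmaller M prev) +
          ((nodeAt (suc p) i (t ∷ ts) + kinds i (t ∷ ts)) + after i prev seen (prefixed M (pieces o (t ∷ ts)))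
          rest)
  desc-prefixed i prev seen p o t ts M rest <M fresh count pⁿ = begin
    descGo i prev seen (M ∷ (word o t ++ W) ++ rest)
      ≡⟨ cong (λ w → descGo i prev seen (M ∷ w)) (++-assoc (word o t) W rest) ⟩
    descGo i prev seen (M ∷ word o t ++ (W ++ rest))
      ≡⟨ descGo-∷ i prev seen M _ p count ⟩
    first + ((if suc p ≡ᵇ i then toBit (nextSmaller M (word o t ++ (W ++ rest))) else 0) +
        descGo i (just M) (M ∷ seen) (word o t ++ (W ++ rest)))
      ≡⟨ cong₂ (λ b z → first + ((if suc p ≡ᵇ i then toBit b else 0) + z))
           (nextSmaller-word o t (W ++ rest) t<M pⁿ′)
           (desc-word i (just M) (M ∷ seen) o t M (W ++ rest) t<M
               (fresh-∷ t<M (fresh ∘ InRange-⊆ˡ o (size t) (sizes ts))) ≤-refl pⁿ′) ⟩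
    first + (bit + (kind i t + descGo i prev′ seen′ (W ++ rest)))
      ≡⟨ cong (λ z → first + (bit + (kind i t + z))) (remaining ts <M fresh) ⟩
    first + (bit + (kind i t + ((nodeAt (suc (suc p)) i ts + kinds i ts) + after i prev′ seen′ W rest)))
      ≡⟨ cong (first +_) (solve 5
          (λ b k n ks a → b :+ (k :+ ((n :+ ks) :+ a)) := ((b :+ n) :+ (k :+ ks)) :+ a) refl bit (kind i t)
          (nodeAt (suc (suc p)) i ts) (kinds i ts) _) ⟩
    first + ((nodeAt (suc p) i (t ∷ ts) + kinds i (t ∷ ts)) + after i prev′ seen′ W rest)
      ≡⟨ cong (λ z → first + ((nodeAt (suc p) i (t ∷ ts) + kinds i (t ∷ ts)) + z))
          (after-++ i (just M) (M ∷ seen) (word o t) W rest) ⟨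
    first + ((nodeAt (suc p) i (t ∷ ts) + kinds i (t ∷ ts)) + after i prev seen (M ∷ word o t ++ W) rest) ∎
    where
    open ≡-Reasoning
    open +-*-Solver
    W     = prefixed M (pieces (o + size t) ts)
    first     = firstBit p i (prevSmaller M prev)
    bit     = if suc p ≡ᵇ i then toBit (isNode t) else 0
    prev′ = lastOr (just M) (word o t)
    seen′ = word o t ʳ++ (M ∷ seen)
    pⁿ′ : AtLeastⁿ M (W ++ rest)
    pⁿ′ = AtLeastⁿ-prefixed M (pieces (o + size t) ts) rest pⁿ
    t<M : o + size t < M
    t<M = ≤-<-trans (+-monoʳ-≤ o (m≤m+n (size t) (sizes ts))) <M
    remaining : ∀ {j} (ts : Vec (Tree (suc (suc _))) j) → o + sizes (t ∷ ts) < M →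
        Fresh o (sizes (t ∷ ts)) seen →
      let W = prefixed M (pieces (o + size t) ts) in
      descGo i prev′ seen′ (W ++ rest) ≡ (nodeAt (suc (suc p)) i ts + kinds i ts) + after i prev′ seen′ W rest
    remaining []       _  _     = refl
    -- One more copy of `M` has been seen, so the term `firstBit (suc p)` of the recursive equation
    -- computes to 0.
    remaining (u ∷ us) <M fresh = desc-prefixed i prev′ seen′ (suc p) (o + size t) u us M rest ts<M
      (fresh-word o t (sizes (u ∷ us)) (fresh-∷ ts<M (fresh ∘ InRange-⊆ʳ o (size t) (sizes (u ∷ us)))))
      (trans (occ-ʳ++ M (word o t) (M ∷ seen))
          (cong₂ _+_ (occ-word-∉ o t t<M) (trans (occ-here M seen) (cong suc count))))
      pⁿ
      where
      ts<M : o + size t + sizes (u ∷ us) < M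
      ts<M = ≤-<-trans (≤-reflexive (+-assoc o (size t) (sizes (u ∷ us)))) <M

descents-word : ∀ i (t : Tree (suc (suc m))) → descents i (word 0 t) ≡ kind i t
descents-word i t = begin
  descGo i nothing [] (word 0 t)        ≡⟨ cong (descGo i nothing []) (++-identityʳ (word 0 t)) ⟨
  descGo i nothing [] (word 0 t ++ [])
    -- The context is empty, so any bound above all letters serves; `suc (size t)` is the least one.
    ≡⟨ desc-word i nothing [] 0 t (suc (size t)) [] ≤-refl (λ _ → refl) tt tt ⟩
  kind i t + 0                          ≡⟨ +-identityʳ _ ⟩
  kind i t                              ∎
  where open ≡-Reasoning

-- Comparison of the counted words with the trees

wordsOver-complete : ∀ {n} w → All (InRange 0 n) w → w ∈ wordsOver (length w) n
wordsOver-complete []                []              = here refl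
wordsOver-complete {n} (suc x ∷ w) ((_ , x≤n) ∷ h) =
  ∈-concatMap⁺ _ {xs = wordsOver (length w) n}
    (lose (wordsOver-complete w h) (∈-map⁺ (_∷ w) (∈-applyUpTo⁺ suc x≤n)))

wordsOver-length : ∀ L {n w} → w ∈ wordsOver L n → length w ≡ L
wordsOver-length zero        (here refl) = refl
wordsOver-length (suc L) {n} w∈ with find (∈-concatMap⁻ _ {xs = wordsOver L n} w∈)
... | v , v∈ , w∈′ with ∈-map⁻ (_∷ v) w∈′
... | _ , _ , refl = cong suc (wordsOver-length L v∈)

wordsOver-unique : ∀ L n → Unique (wordsOver L n)
wordsOver-unique zero    n = [] ∷ []
wordsOver-unique (suc L) n = concatMap-unique _ (wordsOver-unique L n)
  (λ _ → Unique.map⁺ (proj₁ ∘ ∷-injective) (Unique.applyUpTo⁺₁ suc n (λ i<j _ → <⇒≢ (s≤s i<j))))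
  same-tail
  where
  same-tail : ∀ {u v w} → u ∈ wordsOver L n → v ∈ wordsOver L n →
    w ∈ map (_∷ u) (applyUpTo suc n) → w ∈ map (_∷ v) (applyUpTo suc n) → u ≡ v
  same-tail {u} {v} _ _ p q with ∈-map⁻ (_∷ u) p | ∈-map⁻ (_∷ v) q
  ... | _ , _ , refl | _ , _ , refl = refl

Sortable : (r n : ℕ) → (Fin (suc r) → ℕ) → Word → Set
Sortable r n k w =
  (All (InRange 0 n) w × (∀ {a} → InRange 0 n a → occ a w ≡ r) × nestedCond w ≡ true)
  × S w ≡ idPerm n × (∀ i → descents (toℕ i) w ≡ k i)

module _ (r n : ℕ) (k : Fin (suc r) → ℕ) (w : Word) where

  sorted? = ≡-dec _≟_ (S w) (idPerm n)

  descentsᵇ : Fin (suc r) → Bool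
  descentsᵇ i = descents (toℕ i) w ≡ᵇ k i

  counted⁻ : counted r n k w ≡ true → Sortable r n k w
  counted⁻ c =
    let rperm , rest   = Equivalence.to (T-∧ {isRPerm r n w}) (Equivalence.from T-≡ c)
        sorted , descs = Equivalence.to (T-∧ {⌊ sorted? ⌋} {all descentsᵇ (allFin (suc r))}) rest
        letters , rest = Equivalence.to T-∧ rperm
        occs , nested  = Equivalence.to T-∧ rest
    in ( All.map (λ {x} p → let p₁ , p₂ = Equivalence.to T-∧ p in ≤ᵇ⇒≤ 1 x p₁ , ≤ᵇ⇒≤ x n p₂)
        (Allₚ.all⁺ _ w letters)
       , (λ { {suc a} (_ , a≤n) → ≡ᵇ⇒≡ _ r (Allₚ.applyUpTo⁻ suc n (Allₚ.all⁺ _ (applyUpTo suc n) occs) a≤n) })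
       , Equivalence.to T-≡ nested)
     , toWitness {a? = sorted?} sorted
     , λ i → ≡ᵇ⇒≡ _ (k i) (Allₚ.tabulate⁻ {f = id} (Allₚ.all⁺ descentsᵇ (allFin (suc r)) descs) i)

  counted⁺ : Sortable r n k w → counted r n k w ≡ true
  counted⁺ ((letters , occs , nested) , sorted , descs) = Equivalence.to T-≡
    (Equivalence.from (T-∧ {isRPerm r n w})
      ( Equivalence.from T-∧
        ( Allₚ.all⁻ _ (All.map (λ (p₁ , p₂) → Equivalence.from T-∧ (≤⇒≤ᵇ p₁ , ≤⇒≤ᵇ p₂)) letters)
        , Equivalence.from T-∧
          ( Allₚ.all⁻ _ (Allₚ.applyUpTo⁺₁ suc n (λ {a} a<n → ≡⇒≡ᵇ (occ (suc a) w) r (occs (s≤s z≤n , a<n))))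
          , Equivalence.from T-≡ nested))
      , Equivalence.from (T-∧ {⌊ sorted? ⌋} {all descentsᵇ (allFin (suc r))})
        ( fromWitness {a? = sorted?} sorted
        , Allₚ.all⁻ descentsᵇ {xs = allFin (suc r)}
            (Allₚ.tabulate⁺ (λ i → ≡⇒≡ᵇ (descents (toℕ i) w) (k i) (descs i))))))

treeWords : (n : ℕ) → Vec ℕ m → List Word
treeWords n k = map (word 0 ∘ Vec.head) (forests n (true ∷ []) k)

treeWords-unique : ∀ n (k : Vec ℕ (suc (suc m))) → suc (Vec.sum k) ≡ n → Unique (treeWords n k)
treeWords-unique n k h = Unique.map⁺ injective (forests-unique n (true ∷ []) k h)
  where
  injective : {v w : Vec (Tree (suc (suc _))) 1} → word 0 (Vec.head v) ≡ word 0 (Vec.head w) → v ≡ w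
  injective {t ∷ []} {u ∷ []} eq = cong (_∷ []) (word-injective 0 t u eq)

word-sortable : ∀ n (t : Tree (suc (suc m))) → size t ≡ n →
    Sortable (suc m) n (λ i → kind (toℕ i) t) (word 0 t)
word-sortable n t refl =
  (word-range 0 t , word-occ 0 t , word-nested 0 t)
  , trans (stackFuel-word (length (word 0 t)) 0 t ≤-refl) (sym (idPerm-interval n))
  , λ i → descents-word (toℕ i) t

module _ (q : ℕ) (k : Fin (suc (suc q)) → ℕ) (n : ℕ) (size-eq : suc (Vec.sum (tabulate k)) ≡ n) where

  treeWords⇒counted : ∀ {w} → w ∈ treeWords n (tabulate k) →
      w ∈ wordsOver (suc q * n) n × counted (suc q) n k w ≡ true
  treeWords⇒counted w∈ with ∈-map⁻ _ w∈
  ... | t ∷ [] , v∈ , refl with forests-sound n (true ∷ []) (tabulate k) size-eq v∈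
  ... | sizes≡n , _ , kinds≡k with word-sortable n t (trans (sym (+-identityʳ (size t))) sizes≡n)
  ... | rperm , sorted , descs =
    subst (λ L → word 0 t ∈ wordsOver L n)
        (trans (word-length 0 t) (cong (suc q *_) (trans (sym (+-identityʳ (size t))) sizes≡n)))
      (wordsOver-complete (word 0 t) (proj₁ rperm))
    , counted⁺ (suc q) n k (word 0 t) (rperm , sorted , λ i → trans (descs i)
        (trans (sym (+-identityʳ _)) (trans (kinds≡k i) (Vecₚ.lookup∘tabulate k i))))

  counted⇒treeWords : ∀ {w} → counted (suc q) n k w ≡ true → w ∈ treeWords n (tabulate k)
  counted⇒treeWords {w} c with counted⁻ (suc q) n k w c
  ... | (letters , occs , _) , sorted , descs with decode (length w) w 0 n ≤-refl
      (trans sorted (idPerm-interval n)) occs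
  ... | leaf , _ , 0≡n = contradiction (trans 0≡n (sym size-eq)) 0≢1+n
  ... | t@(node _) , word≡w , size≡n = subst (_∈ treeWords n (tabulate k)) word≡w
    (∈-map⁺ (word 0 ∘ Vec.head) (forests-complete n (true ∷ []) (tabulate k) {t ∷ []}
      (trans (+-identityʳ (size t)) size≡n) refl
      (λ i → trans (+-identityʳ _)
          (trans (sym (descents-word (toℕ i) t)) (trans (cong (descents (toℕ i)) word≡w)
               (trans (descs i) (sym (Vecₚ.lookup∘tabulate k i))))))))

  -- Two lists without repetitions and with the same members are permutations of each other; no
  -- explicit bijection is needed beyond `word 0`.
  countRPerms≡length : countRPerms (suc q) n k ≡ length (forests {m = suc (suc q)} n (true ∷ []) (tabulate k))
  countRPerms≡length = trans
    (↭-length (∼bag⇒↭ (unique∧set⇒bag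
      (Unique.filter⁺ P? (wordsOver-unique (suc q * n) n))
      (treeWords-unique n (tabulate k) size-eq)
      (mk⇔ (counted⇒treeWords ∘ proj₂ ∘ ∈-filter⁻ P? {xs = wordsOver (suc q * n) n})
           (λ w∈ → let w∈′ , c = treeWords⇒counted w∈ in ∈-filter⁺ P? w∈′ c)))))
    (length-map _ (forests n (true ∷ []) (tabulate k)))
    where P? = λ w → counted (suc q) n k w Bool.≟ true

sumFin≡sum : ∀ m (k : Fin m → ℕ) → Vec.sum (tabulate k) ≡ sumFin m k
sumFin≡sum zero    k = refl
sumFin≡sum (suc m) k = cong (k zero +_) (sumFin≡sum m (k ∘ suc))

prodFin≡binomials : ∀ n m (k : Fin m → ℕ) → binomials n (tabulate k) ≡ prodFin m (λ i → n C k i)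
prodFin≡binomials n zero    k = refl
prodFin≡binomials n (suc m) k = cong ((n C k zero) *_) (prodFin≡binomials n m (k ∘ suc))

theorem1 : (r : ℕ) → 1 ≤ r → (k : Fin (suc r) → ℕ) →
    suc (sumFin (suc r) k) * countRPerms r (suc (sumFin (suc r) k)) k
    ≡ prodFin (suc r) (λ i → suc (sumFin (suc r) k) C k i)
theorem1 r@(suc q) _ k = begin
  N * countRPerms r N k                                  ≡⟨ cong (N *_) (countRPerms≡length q k N size-eq) ⟩
  N * length (forests N (true ∷ []) (tabulate k))
    -- A tree is a forest with one root, so the number of roots in the general formula is 1.
    ≡⟨ length-forests N (true ∷ []) (tabulate k) size-eq ⟩
  1 * binomials N (tabulate k)                           ≡⟨ *-identityˡ _ ⟩
  binomials N (tabulate k)                               ≡⟨ prodFin≡binomials N (suc r) k ⟩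
  prodFin (suc r) (λ i → N C k i)                        ∎
  where
  open ≡-Reasoning
  N = suc (sumFin (suc r) k)
  size-eq : suc (Vec.sum (tabulate k)) ≡ N
  size-eq = cong suc (sumFin≡sum (suc r) k)
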